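{- Let $r\ge 3$ be a positive integer and let $n\ge 3$ be an odd integer. Then $$\mathsf s(C_2^{r-1}\oplus C_{2n})\le 4n+2^r-5.$$
   Context: $C_m$ denotes the cyclic group of order $m$, and $C_m^k$ the direct sum of $k$ copies of $C_m$. Groups are finite abelian, written additively; $\exp(G)$ is the exponent of $G$. A sequence over $G$ is a finite unordered sequence of elements of $G$ with repetition allowed (a multiset; an element of the free abelian monoid with basis $G$). Its length is the number of terms counted with multiplicity; a subsequence is a sub-multiset; it is zero-sum if the sum of its terms (with multiplicity) is $0$. The Erdős–Ginzburg–Ziv constant $\mathsf s(G)$ is the smallest positive integer $l$ such that every sequence $S$ over $G$ of length $|S|\ge l$ has a zero-sum subsequence $T$ of length $|T|=\exp(G)$. -}

module Defs where

open import Algebra.Bundles using (AbelianGroup)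
import Algebra.Construct.DirectProduct as DirectProduct
import Algebra.Construct.Terminal as Terminal
import Algebra.Definitions.RawMonoid as RawMonoidDefs
open import Data.Fin.Base using (Fin; toℕ)
open import Data.Fin.Properties using (toℕ-injective; toℕ-fromℕ<; toℕ<n)
open import Data.List.Base using (List; length; foldr; _++_)
import Data.List.Relation.Binary.Permutation.Setoid as Permutation
open import Data.Nat.Base
  using (ℕ; zero; suc; _+_; _∸_; _≤_; _<_; NonZero; >-nonZero⁻¹)
open import Data.Nat.DivMod
  using (_%_; _mod_; m%n<n; m<n⇒m%n≡m; %-distribˡ-+; n%n≡0; m%n%n≡m%n)
open import Data.Nat.Properties using (+-comm; +-assoc; m+[n∸m]≡n; <⇒≤)
open import Data.Product.Base using (_×_; _,_; ∃-syntax)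
open import Level using (Level; 0ℓ; _⊔_)
open import Relation.Binary.PropositionalEquality
  using (_≡_; sym; trans; cong; cong₂; isEquivalence; module ≡-Reasoning)

private
  variable
    a ℓ p : Level

module _ (m : ℕ) .{{_ : NonZero m}} where

  0ₘ : Fin m
  0ₘ = 0 mod m

  infixl 6 _+ₘ_
  _+ₘ_ : Fin m → Fin m → Fin m
  x +ₘ y = (toℕ x + toℕ y) mod m

  -ₘ_ : Fin m → Fin m
  -ₘ x = (m ∸ toℕ x) mod m

  private
    toℕ-mod : ∀ k → toℕ (k mod m) ≡ k % m
    toℕ-mod k = toℕ-fromℕ< (m%n<n k m)

    toℕ-% : ∀ (x : Fin m) → toℕ x % m ≡ toℕ x
    toℕ-% x = m<n⇒m%n≡m (toℕ<n x)

    mod-cong : ∀ {j k} → j % m ≡ k % m → j mod m ≡ k mod m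
    mod-cong {j} {k} eq =
      toℕ-injective (trans (toℕ-mod j) (trans eq (sym (toℕ-mod k))))

    mod-toℕ : ∀ x → toℕ x mod m ≡ x
    mod-toℕ x = toℕ-injective (trans (toℕ-mod (toℕ x)) (toℕ-% x))

    absorbˡ : ∀ j k → (toℕ (j mod m) + k) % m ≡ (j + k) % m
    absorbˡ j k = begin
      (toℕ (j mod m) + k) % m      ≡⟨ cong (λ i → (i + k) % m) (toℕ-mod j) ⟩
      (j % m + k) % m              ≡⟨ %-distribˡ-+ (j % m) k m ⟩
      (j % m % m + k % m) % m      ≡⟨ cong (λ i → (i + k % m) % m) (m%n%n≡m%n j m) ⟩
      (j % m + k % m) % m          ≡⟨ %-distribˡ-+ j k m ⟨
      (j + k) % m                  ∎
      where open ≡-Reasoning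

    absorbʳ : ∀ j k → (j + toℕ (k mod m)) % m ≡ (j + k) % m
    absorbʳ j k = trans (cong (_% m) (+-comm j _))
      (trans (absorbˡ k j) (cong (_% m) (+-comm k j)))

    comm : ∀ x y → x +ₘ y ≡ y +ₘ x
    comm x y = cong (_mod m) (+-comm (toℕ x) (toℕ y))

    assoc : ∀ x y z → (x +ₘ y) +ₘ z ≡ x +ₘ (y +ₘ z)
    assoc x y z = mod-cong (trans (absorbˡ (toℕ x + toℕ y) (toℕ z))
      (trans (cong (_% m) (+-assoc (toℕ x) (toℕ y) (toℕ z)))
             (sym (absorbʳ (toℕ x) (toℕ y + toℕ z)))))

    identityˡ : ∀ x → 0ₘ +ₘ x ≡ x
    identityˡ x = trans (mod-cong (absorbˡ 0 (toℕ x))) (mod-toℕ x)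

    inverseʳ : ∀ x → x +ₘ (-ₘ x) ≡ 0ₘ
    inverseʳ x = mod-cong (trans (absorbʳ (toℕ x) (m ∸ toℕ x))
      (trans (cong (_% m) (m+[n∸m]≡n (<⇒≤ (toℕ<n x))))
             (trans (n%n≡0 m) (sym (m<n⇒m%n≡m 0<m)))))
      where
      0<m : 0 < m
      0<m = >-nonZero⁻¹ m

  C : AbelianGroup 0ℓ 0ℓ
  C = record
    { Carrier = Fin m
    ; _≈_     = _≡_
    ; _∙_     = _+ₘ_
    ; ε       = 0ₘ
    ; _⁻¹     = -ₘ_
    ; isAbelianGroup = record
      { isGroup = record
        { isMonoid = record
          { isSemigroup = record
            { isMagma = record
              { isEquivalence = isEquivalence
              ; ∙-cong        = cong₂ _+ₘ_
              }
            ; assoc = assoc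
            }
          ; identity = identityˡ , λ x → trans (comm x 0ₘ) (identityˡ x)
          }
        ; inverse = (λ x → trans (comm (-ₘ x) x) (inverseʳ x)) , inverseʳ
        ; ⁻¹-cong = cong -ₘ_
        }
      ; comm = comm
      }
    }

infixr 6 _⊕_
_⊕_ : AbelianGroup a ℓ → AbelianGroup a ℓ → AbelianGroup a ℓ
_⊕_ = DirectProduct.abelianGroup

infixr 8 _^⊕_
_^⊕_ : AbelianGroup a ℓ → ℕ → AbelianGroup a ℓ
G ^⊕ zero  = Terminal.abelianGroup
G ^⊕ suc k = G ⊕ (G ^⊕ k)

IsLeastPositive : (ℕ → Set p) → ℕ → Set p
IsLeastPositive P m = 0 < m × P m × (∀ k → 0 < k → P k → m ≤ k)

module _ (G : AbelianGroup a ℓ) where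
  open AbelianGroup G using (Carrier; _≈_; _∙_; ε; setoid; rawMonoid)
  open Permutation setoid using (_↭_)
  open RawMonoidDefs rawMonoid using () renaming (_×_ to _·_)

  IsExponent : ℕ → Set (a ⊔ ℓ)
  IsExponent = IsLeastPositive (λ e → ∀ g → e · g ≈ ε)

  -- Sequences are unordered, so a list stands for its class under _↭_
  -- (permutation up to the equality of G).

  Sequence : Set a
  Sequence = List Carrier

  σ : Sequence → Carrier
  σ = foldr _∙_ ε

  ZeroSum : Sequence → Set ℓ
  ZeroSum S = σ S ≈ ε

  Subsequence : Sequence → Sequence → Set (a ⊔ ℓ)
  Subsequence T S = ∃[ U ] (T ++ U) ↭ S

  EGZProperty : (e l : ℕ) → Set (a ⊔ ℓ)
  EGZProperty e l = ∀ (S : Sequence) → l ≤ length S →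
    ∃[ T ] Subsequence T S × ZeroSum T × length T ≡ e

  -- The constant is given as a relation, "l is s(G)": for a general
  -- abelian group neither the exponent nor the constant need exist, but each
  -- is unique when it does.

  IsEGZConstant : ℕ → Set (a ⊔ ℓ)
  IsEGZConstant l = ∃[ e ] IsExponent e × IsLeastPositive (EGZProperty e) l

{-# OPTIONS --safe #-}

-- Write the group as V ⊕ C_n with V = C_2^r (parity splits off C_2 from C_2n), and put
-- N = 2^r.  If the bound 4m + N - 5 holds with m in place of n, it holds for q m: extract
-- 2q - 1 disjoint blocks of length 2m with sum in m C_qm ≅ C_q and apply
-- Erdős–Ginzburg–Ziv.  So n = p is an odd prime.
--
-- Match terms of equal V-class into pairs P until the rest R has distinct classes.  With
-- 2p - 1 pairs Erdős–Ginzburg–Ziv finishes; otherwise |P| = 2p - 2 and |R| = N - 1.  Unless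
-- p pairs have equal sums, the pairs can be grouped into p - 1 couples with distinct sums,
-- and by Cauchy–Davenport choosing one pair from each of p - 2 couples reaches all residues
-- but at most one.  Hence the last couple and every four terms of R with zero class sum
-- (an affine plane of V) have the same sum Q.  This forces the values on R to be a constant
-- u with 4u = Q.  A pair in a class that R represents can exchange a term with R, so its
-- values are u too, and its sum 2u = Q/2 equals that of its partner, a contradiction.
-- So all 4p - 4 paired terms lie in the one class omitted by R, and Erdős–Ginzburg–Ziv
-- applies twice to them.
module Submission where

open import Defs
open import Algebra.Bundles using (AbelianGroup)
open import Algebra.Properties.CommutativeSemigroup using (interchange; x∙yz≈y∙xz)
import Algebra.Properties.Group as GroupProperties
import Algebra.Properties.Monoid.Mult as Mult
open import Data.Bool using (Bool; true; false; _xor_; if_then_else_)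
import Data.Bool.Properties as Bool
open import Data.Empty using (⊥)
open import Data.Fin.Base as Fin using (Fin; toℕ; combine; remQuot)
open import Data.Fin.Properties as Fin
  using (toℕ-injective; toℕ-fromℕ<; toℕ<n; all?; combine-remQuot; remQuot-combine)
open import Data.List.Base
  using (List; []; _∷_; _++_; length; map; lookup; take; drop; concat)
import Data.List.Membership.DecPropositional as DecMembership
open import Data.List.Membership.Propositional using (_∈_; _∉_; find)
open import Data.List.Membership.Propositional.Properties
  using (∈-map⁻; ∈-map⁺; ∈-lookup; ∈-++⁺ˡ)
open import Data.List.Membership.Setoid.Properties using (index-injective)
open import Data.List.Properties
  using (length-map; length-++; map-++; map-∘; map-cong; ++-assoc; take++drop≡id; length-take; concat-++)
open import Data.List.Relation.Binary.Permutation.Propositional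
  using (_↭_; ↭-refl; ↭-sym; ↭-trans; ↭-reflexive; prep; swap; refl; trans; ↭⇒↭ₛ′; module PermutationReasoning)
open import Data.List.Relation.Binary.Permutation.Propositional.Properties
  using (↭-length; ++⁺; ++⁺ˡ; ++⁺ʳ; ++-comm; shift; All-resp-↭; ∈-resp-↭) renaming (map⁺ to ↭-map⁺)
import Data.List.Relation.Binary.Permutation.Setoid as Permutation
import Data.List.Relation.Binary.Permutation.Setoid.Properties as SetoidPermutation
open import Data.List.Relation.Binary.Pointwise using (Pointwise; []; _∷_)
open import Data.List.Relation.Unary.All as All using (All; []; _∷_)
import Data.List.Relation.Unary.All.Properties as All
open import Data.List.Relation.Unary.AllPairs as AllPairs using ([]; _∷_)
open import Data.List.Relation.Unary.Any as Any using (here; there)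
open import Data.List.Relation.Unary.Unique.DecPropositional using (unique?)
open import Data.List.Relation.Unary.Unique.Propositional using (Unique)
import Data.List.Relation.Unary.Unique.Propositional.Properties as Unique
open import Data.Nat using (ℕ; zero; suc; _+_; _*_; _∸_; _^_; _≤_; _<_; _%_; NonZero;
  z≤n; s≤s; s≤s⁻¹; pred; >-nonZero; >-nonZero⁻¹; nonTrivial⇒n>1)
open import Data.Nat.Coprimality using (Coprime; coprime-Bézout; coprime-divisor; prime⇒coprime)
open import Data.Nat.Divisibility
  using (_∣_; divides; _∣0; ∣-refl; ∣-trans; ∣⇒≤; m%n≡0⇒n∣m; n∣m⇒m%n≡0; ∣m+n∣m⇒∣n; m∣m*n; n∣m*n; *-monoˡ-∣; *-monoʳ-∣)
open import Data.Nat.DivMod using (_/_; _mod_; m%n<n; m<n⇒m%n≡m; %-distribˡ-+; m*[n/m]≡n)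
open import Data.Nat.GCD using (module Bézout)
open import Data.Nat.ListAction using (sum; product)
open import Data.Nat.ListAction.Properties using (sum-++)
open import Data.Nat.Primality
  using (Prime; prime[2]; prime⇒nonZero; prime⇒nonTrivial; prime⇒irreducible; euclidsLemma; productOfPrimes≥1)
open import Data.Nat.Primality.Factorisation using (factorise; PrimeFactorisation)
open import Data.Nat.Properties
open import Data.Nat.Tactic.RingSolver using (solve-∀)
open import Data.Product using (_×_; ∃-syntax; _,_; proj₁; proj₂)
open import Data.Sum using (_⊎_; inj₁; inj₂; [_,_]′)
open import Data.Unit.Polymorphic using (tt)
open import Data.Vec as Vec using (Vec; []; _∷_; zipWith; replicate)
open import Data.Vec.Properties using (≡-dec)
open import Function using (Inverse; _∘_)
open import Level using (Level; Setω; 0ℓ)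
open import Relation.Binary.PropositionalEquality
  using (_≡_; _≢_; refl; sym; cong; cong₂; subst; setoid; isEquivalence; module ≡-Reasoning)
  renaming (trans to ≡-trans)
import Relation.Binary.Reasoning.Setoid as ≈-Reasoning
open import Relation.Nullary using (¬_; Dec; yes; no; contradiction; _⊎-dec_)
open import Relation.Nullary.Decidable
  using (True; False; toWitness; toWitnessFalse; decidable-stable; map′; _×-dec_)
open import Relation.Unary using (Decidable)

private
  variable
    a b c ℓ : Level
    A : Set a
    B : Set b
    X : Set a

-- Lists up to permutation

flat : List (A × A) → List A
flat []             = []
flat ((x , y) ∷ ps) = x ∷ y ∷ flat ps

flat-↭ : {ps qs : List (A × A)} → ps ↭ qs → flat ps ↭ flat qs
flat-↭ refl           = refl
flat-↭ (prep _ p)     = prep _ (prep _ (flat-↭ p))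
flat-↭ (swap (x , y) (z , w) p) = ↭-trans
  (++⁺ʳ _ (++-comm (x ∷ y ∷ []) (z ∷ w ∷ [])))
  (prep z (prep w (prep x (prep y (flat-↭ p)))))
flat-↭ (trans p q)    = trans (flat-↭ p) (flat-↭ q)

flat-++ : (ps qs : List (A × A)) → flat (ps ++ qs) ≡ flat ps ++ flat qs
flat-++ []             qs = refl
flat-++ ((x , y) ∷ ps) qs = cong (λ zs → x ∷ y ∷ zs) (flat-++ ps qs)

length-flat : (ps : List (A × A)) → length (flat ps) ≡ 2 * length ps
length-flat []       = refl
length-flat (_ ∷ ps) = ≡-trans (cong (suc ∘ suc) (length-flat ps))
  (sym (*-suc 2 (length ps)))

Unique-resp-↭ : {xs ys : List A} → xs ↭ ys → Unique xs → Unique ys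
Unique-resp-↭ p = SetoidPermutation.Unique-resp-↭ (setoid _)
  (↭⇒↭ₛ′ isEquivalence p)

∈⇒↭ : {x : A} {xs : List A} → x ∈ xs → ∃[ ys ] xs ↭ x ∷ ys
∈⇒↭ {xs = _ ∷ xs} (here refl) = xs , ↭-refl
∈⇒↭ {xs = z ∷ _}  (there x∈)  with ys , p ← ∈⇒↭ x∈ =
  z ∷ ys , ↭-trans (prep z p) (swap z _ ↭-refl)

-- Distinctness keeps the remaining members of `xs` inside what is left of `ys` once one occurrence
-- of `x` has been taken out.
unique-⊆⇒↭ : {xs ys : List A} → Unique xs → All (_∈ ys) xs → ∃[ zs ] ys ↭ xs ++ zs
unique-⊆⇒↭ {ys = ys} []          []          = ys , ↭-refl
unique-⊆⇒↭ {xs = x ∷ xs} (x∉xs ∷ uniq) (x∈ys ∷ xs⊆ys)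
  with ys′ , p ← ∈⇒↭ x∈ys
  with zs , q ← unique-⊆⇒↭ uniq
         (All.zipWith (λ { (x≢y , y∈ys) → Any.tail (x≢y ∘ sym) (∈-resp-↭ p y∈ys) }) (x∉xs , xs⊆ys))
  = zs , ↭-trans p (prep x q)

-- Pigeonhole: if every element occurred in `xs`, sending it to its position would inject `Fin N`
-- into a smaller set.
fin-missing : ∀ {N} (xs : List (Fin N)) → length xs < N → ∃[ i ] i ∉ xs
fin-missing {N} xs short = Fin.¬∀⟶∃¬ N (_∈ xs) (_∈? xs) λ all →
  <⇒≱ short (Fin.injective⇒≤ {f = λ i → Any.index (all i)}
    λ {i} {j} → index-injective (setoid _) (all i) (all j))
  where
  open DecMembership Fin._≟_ using (_∈?_)

lookup-injective : {xs : List A} → Unique xs → ∀ i j → lookup xs i ≡ lookup xs j → i ≡ j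
lookup-injective (_ ∷ _)    Fin.zero    Fin.zero    _  = refl
lookup-injective (x∉ ∷ _)   Fin.zero    (Fin.suc j) eq =
  contradiction eq (All.lookup x∉ (∈-lookup j))
lookup-injective (x∉ ∷ _)   (Fin.suc i) Fin.zero    eq =
  contradiction (sym eq) (All.lookup x∉ (∈-lookup i))
lookup-injective (_ ∷ uniq) (Fin.suc i) (Fin.suc j) eq =
  cong Fin.suc (lookup-injective uniq i j eq)

unique-length : ∀ {N} {xs : List (Fin N)} → Unique xs → length xs ≤ N
unique-length uniq = Fin.injective⇒≤ (lookup-injective uniq _ _)

-- A missing element could be prepended, giving a duplicate-free list longer than `N`.
unique-full : ∀ {N} {xs : List (Fin N)} → Unique xs → N ≤ length xs → ∀ i → i ∈ xs
unique-full {xs = xs} uniq N≤ i with DecMembership._∈?_ Fin._≟_ i xs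
... | yes i∈ = i∈
... | no  i∉ = contradiction N≤ (<⇒≱ (unique-length (All.¬Any⇒All¬ xs i∉ ∷ uniq)))

-- Sums and residues

module _ (G : AbelianGroup c ℓ) where
  open AbelianGroup G
  private module G = AbelianGroup G

  σ-++ : ∀ xs ys → σ G (xs ++ ys) ≈ σ G xs ∙ σ G ys
  σ-++ []       ys = G.sym (identityˡ _)
  σ-++ (x ∷ xs) ys = G.trans (∙-congˡ (σ-++ xs ys)) (G.sym (assoc x _ _))

  σ-map-++ : (f : X → Carrier) → ∀ xs ys → σ G (map f (xs ++ ys)) ≈ σ G (map f xs) ∙ σ G (map f ys)
  σ-map-++ f xs ys = G.trans (G.reflexive (cong (σ G) (map-++ f xs ys))) (σ-++ (map f xs) (map f ys))

module Residues (m : ℕ) .{{_ : NonZero m}} where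
  open AbelianGroup (C m) public
    using (assoc; comm; identityˡ; identityʳ; inverseˡ; inverseʳ; group; commutativeSemigroup)
    renaming (_∙_ to _⊹_; ε to 𝟘; _⁻¹ to ⊖_; _-_ to _⊟_)
  open Mult (AbelianGroup.monoid (C m)) public
    using (×-homo-+) renaming (_×_ to _·_)

  [_] : ℕ → Fin m
  [ k ] = k mod m

  toℕ-[] : ∀ k → toℕ [ k ] ≡ k % m
  toℕ-[] k = toℕ-fromℕ< (m%n<n k m)

  []-cong : ∀ {j k} → j % m ≡ k % m → [ j ] ≡ [ k ]
  []-cong {j} {k} eq = toℕ-injective (≡-trans (toℕ-[] j) (≡-trans eq (sym (toℕ-[] k))))

  []-toℕ : ∀ i → [ toℕ i ] ≡ i
  []-toℕ i = toℕ-injective (≡-trans (toℕ-[] (toℕ i)) (m<n⇒m%n≡m (toℕ<n i)))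

  []-homo-+ : ∀ j k → [ j + k ] ≡ [ j ] ⊹ [ k ]
  []-homo-+ j k = []-cong (≡-trans (%-distribˡ-+ j k m)
    (cong (_% m) (cong₂ _+_ (sym (toℕ-[] j)) (sym (toℕ-[] k)))))

  []≡𝟘⇒∣ : ∀ {k} → [ k ] ≡ 𝟘 → m ∣ k
  []≡𝟘⇒∣ {k} eq = m%n≡0⇒n∣m k m
    (≡-trans (sym (toℕ-[] k)) (≡-trans (cong toℕ eq) (≡-trans (toℕ-[] 0) (n∣m⇒m%n≡0 0 m (m ∣0)))))

  ∣⇒[]≡𝟘 : ∀ {k} → m ∣ k → [ k ] ≡ 𝟘
  ∣⇒[]≡𝟘 {k} m∣k = []-cong (≡-trans (n∣m⇒m%n≡0 k m m∣k) (sym (n∣m⇒m%n≡0 0 m (m ∣0))))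

  []-sum : (f : X → ℕ) → ∀ xs → [ sum (map f xs) ] ≡ σ (C m) (map ([_] ∘ f) xs)
  []-sum f []       = refl
  []-sum f (x ∷ xs) = ≡-trans ([]-homo-+ (f x) _) (cong ([ f x ] ⊹_) ([]-sum f xs))

  []-homo-· : ∀ k j → k · [ j ] ≡ [ k * j ]
  []-homo-· zero    j = refl
  []-homo-· (suc k) j = ≡-trans (cong ([ j ] ⊹_) ([]-homo-· k j)) (sym ([]-homo-+ j (k * j)))

  ∣⇒·≡𝟘 : ∀ {k} i → m ∣ k → k · i ≡ 𝟘
  ∣⇒·≡𝟘 {k} i (divides q refl) = begin
    k · i            ≡⟨ cong (k ·_) ([]-toℕ i) ⟨
    k · [ toℕ i ]    ≡⟨ []-homo-· k (toℕ i) ⟩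
    [ k * toℕ i ]    ≡⟨ ∣⇒[]≡𝟘 (∣-trans (n∣m*n q) (m∣m*n (toℕ i))) ⟩
    𝟘                ∎
    where open ≡-Reasoning

module PrimeResidues {p : ℕ} (p-prime : Prime p) where
  private instance
    p≢0 : NonZero p
    p≢0 = prime⇒nonZero p-prime
  open Residues p
  open GroupProperties group using (x∙y⁻¹≈ε⇒x≈y)

  -- A nonzero residue modulo a prime is invertible, and Bézout's identity supplies the inverse up
  -- to sign.
  multiples-cover : ∀ {d} → d ≢ 𝟘 → ∀ t → ∃[ k ] k · d ≡ t
  multiples-cover {d} d≢𝟘 t with toℕ d in d-eq
  ... | zero  = contradiction (≡-trans (sym ([]-toℕ d)) (cong [_] d-eq)) d≢𝟘
  ... | suc e with coprime-Bézout (prime⇒coprime p-prime (subst (_< p) d-eq (toℕ<n d)))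
  -- `1 + y * suc e = x * p` makes `y` minus the inverse of `d`, so the multiplier uses a
  -- representative `s` of `⊖ t`.
  ... | Bézout.+- x y bézout = y * s , kd≡t
    where
    open ≡-Reasoning
    s = toℕ (⊖ t)
    kd⊟t≡𝟘 : (y * s) · d ⊹ ⊖ t ≡ 𝟘
    kd⊟t≡𝟘 = begin
      (y * s) · d ⊹ ⊖ t                     ≡⟨ cong₂ (λ i j → (y * s) · i ⊹ j) ([]-toℕ d) ([]-toℕ (⊖ t)) ⟨
      (y * s) · [ toℕ d ] ⊹ [ s ]           ≡⟨ cong (λ i → (y * s) · [ i ] ⊹ [ s ]) d-eq ⟩
      (y * s) · [ suc e ] ⊹ [ s ]           ≡⟨ cong (_⊹ [ s ]) ([]-homo-· (y * s) (suc e)) ⟩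
      [ y * s * suc e ] ⊹ [ s ]             ≡⟨ []-homo-+ (y * s * suc e) s ⟨
      [ y * s * suc e + s ]                 ≡⟨ cong [_] (rearrange y s (suc e)) ⟩
      [ (1 + y * suc e) * s ]               ≡⟨ ∣⇒[]≡𝟘 (divides (x * s) (≡-trans (cong (_* s) bézout) (swap-factors x p s))) ⟩
      𝟘                                     ∎
      where
      rearrange : ∀ y s e → y * s * e + s ≡ (1 + y * e) * s
      rearrange = solve-∀
      swap-factors : ∀ x p s → x * p * s ≡ x * s * p
      swap-factors = solve-∀
    kd≡t : (y * s) · d ≡ t
    kd≡t = x∙y⁻¹≈ε⇒x≈y _ _ kd⊟t≡𝟘
  ... | Bézout.-+ x y bézout = toℕ t * y , (begin
      (toℕ t * y) · d                 ≡⟨ cong ((toℕ t * y) ·_) ([]-toℕ d) ⟨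
      (toℕ t * y) · [ toℕ d ]         ≡⟨ cong (λ i → (toℕ t * y) · [ i ]) d-eq ⟩
      (toℕ t * y) · [ suc e ]         ≡⟨ []-homo-· (toℕ t * y) (suc e) ⟩
      [ toℕ t * y * suc e ]           ≡⟨ cong [_] (≡-trans (*-assoc (toℕ t) y (suc e)) (cong (toℕ t *_) (sym bézout))) ⟩
      [ toℕ t * (1 + x * p) ]         ≡⟨ cong [_] (expand (toℕ t) x p) ⟩
      [ toℕ t + toℕ t * x * p ]       ≡⟨ []-homo-+ (toℕ t) _ ⟩
      [ toℕ t ] ⊹ [ toℕ t * x * p ]   ≡⟨ cong₂ _⊹_ ([]-toℕ t) (∣⇒[]≡𝟘 (n∣m*n (toℕ t * x))) ⟩
      t ⊹ 𝟘                           ≡⟨ identityʳ t ⟩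
      t                               ∎)
    where
    open ≡-Reasoning
    expand : ∀ t x p → t * (1 + x * p) ≡ t + t * x * p
    expand = solve-∀

  -- Twice the difference is divisible by `p`; by Euclid's lemma and `3 ≤ p`, so is the difference.
  double-injective : 3 ≤ p → ∀ {x y} → x ⊹ x ≡ y ⊹ y → x ≡ y
  double-injective 3≤p {x} {y} 2x≡2y = x∙y⁻¹≈ε⇒x≈y x y ([d]≡𝟘 (euclidsLemma 2 (toℕ d) p-prime ([]≡𝟘⇒∣ [2d]≡𝟘)))
    where
    open ≡-Reasoning
    d = x ⊟ y
    [2d]≡𝟘 : [ 2 * toℕ d ] ≡ 𝟘
    [2d]≡𝟘 = begin
      [ 2 * toℕ d ]               ≡⟨ cong (λ k → [ toℕ d + k ]) (+-identityʳ (toℕ d)) ⟩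
      [ toℕ d + toℕ d ]           ≡⟨ []-homo-+ (toℕ d) (toℕ d) ⟩
      [ toℕ d ] ⊹ [ toℕ d ]       ≡⟨ cong₂ _⊹_ ([]-toℕ d) ([]-toℕ d) ⟩
      (x ⊹ ⊖ y) ⊹ (x ⊹ ⊖ y)       ≡⟨ interchange commutativeSemigroup x (⊖ y) x (⊖ y) ⟩
      (x ⊹ x) ⊹ (⊖ y ⊹ ⊖ y)       ≡⟨ cong (_⊹ (⊖ y ⊹ ⊖ y)) 2x≡2y ⟩
      (y ⊹ y) ⊹ (⊖ y ⊹ ⊖ y)       ≡⟨ interchange commutativeSemigroup y y (⊖ y) (⊖ y) ⟩
      (y ⊹ ⊖ y) ⊹ (y ⊹ ⊖ y)       ≡⟨ cong₂ _⊹_ (inverseʳ y) (inverseʳ y) ⟩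
      𝟘 ⊹ 𝟘                       ≡⟨ identityˡ 𝟘 ⟩
      𝟘                           ∎
    [d]≡𝟘 : p ∣ 2 ⊎ p ∣ toℕ d → d ≡ 𝟘
    [d]≡𝟘 (inj₁ p∣2) = contradiction (∣⇒≤ p∣2) (<⇒≱ 3≤p)
    [d]≡𝟘 (inj₂ p∣d) = ≡-trans (sym ([]-toℕ d)) (∣⇒[]≡𝟘 p∣d)

-- The complement `U` is kept so that further selections can be made from what is left.
Selects : (List A → Set ℓ) → List A → Set _
Selects P S = ∃[ T ] ∃[ U ] T ++ U ↭ S × P T

Selects-⊆ : {P : List A → Set ℓ} {S S′ : List A} (R : List A) → S ++ R ↭ S′ → Selects P S → Selects P S′
Selects-⊆ R S++R↭S′ (T , U , T++U↭S , PT) = T , U ++ R ,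
  ↭-trans (↭-reflexive (sym (++-assoc T U R))) (↭-trans (++⁺ʳ R T++U↭S) S++R↭S′) , PT

splitAt-length : ∀ n (xs : List A) → n ≤ length xs →
  ∃[ ys ] ∃[ zs ] ys ++ zs ↭ xs × length ys ≡ n
splitAt-length n xs n≤ = take n xs , drop n xs , ↭-reflexive (take++drop≡id n xs) ,
  ≡-trans (length-take n xs) (m≤n⇒m⊓n≡m n≤)

-- Couples with distinct residues

odd≢even : ∀ m n → suc (2 * m) ≢ 2 * n
odd≢even m n eq = contradiction (∣⇒≤ (∣m+n∣m⇒∣n (divides n lemma) (m∣m*n m))) λ { (s≤s ()) }
  where
  lemma : 2 * m + 1 ≡ n * 2
  lemma = ≡-trans (+-comm (2 * m) 1) (≡-trans eq (*-comm 2 n))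

module Coupling {B : Set b} {m : ℕ} (f : B → Fin m) where

  Distinct : B × B → Set
  Distinct (x , y) = f x ≢ f y

  private
    -- With the value `c` in front, `map proj₁` later collects its occurrences in the couples.
    Leads : Fin m → B × B → Set
    Leads c (x , y) = f x ≡ c × f y ≢ c

    -- Two equal leftovers are absorbed by a couple avoiding their value; if there is
    -- none, their value occurs in every couple.
    data Coupled (L : List B) : Set b where
      even      : ∀ K → flat K ↭ L → All Distinct K → Coupled L
      odd       : ∀ K z → z ∷ flat K ↭ L → All Distinct K → Coupled L
      dominated : ∀ c K z Z → (z ∷ Z) ++ flat K ↭ L → All (Leads c) K →
                  All (λ x → f x ≡ c) (z ∷ Z) → Coupled L

    leads⇒distinct : ∀ {c} xy → Leads c xy → Distinct xy
    leads⇒distinct _ (fx≡c , fy≢c) fx≡fy = fy≢c (≡-trans (sym fx≡fy) fx≡c)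

    Meets : Fin m → B × B → Set
    Meets c (x , y) = f x ≡ c ⊎ f y ≡ c

    -- In a distinct couple the value `c` occurs in only one coordinate, which can be moved to the
    -- front.
    orient : ∀ c K → All Distinct K → All (Meets c) K →
             ∃[ K′ ] flat K′ ↭ flat K × All (Leads c) K′
    orient c []            []         []         = [] , ↭-refl , []
    orient c ((x , y) ∷ K) (x≢y ∷ ds) (m ∷ ms)
      with K′ , p , ls ← orient c K ds ms | m
    ... | inj₁ fx≡c = (x , y) ∷ K′ , prep x (prep y p) ,
                      (fx≡c , λ fy≡c → x≢y (≡-trans fx≡c (sym fy≡c))) ∷ ls
    ... | inj₂ fy≡c = (y , x) ∷ K′ , swap y x p ,
                      (fy≡c , λ fx≡c → x≢y (≡-trans fx≡c (sym fy≡c))) ∷ ls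

    insert : ∀ x {L} → Coupled L → Coupled (x ∷ L)
    insert x (even K p ds) = odd K x (prep x p) ds
    insert x (odd K z p ds) with f x Fin.≟ f z
    ... | no  x≢z = even ((x , z) ∷ K) (prep x p) (x≢z ∷ ds)
    ... | yes x≡z with All.all? (λ (u , v) → (f u Fin.≟ f z) ⊎-dec (f v Fin.≟ f z)) K
    ...   | yes ms with K′ , q , ls ← orient (f z) K ds ms =
      dominated (f z) K′ x (z ∷ []) (prep x (↭-trans (prep z q) p)) ls (x≡z ∷ refl ∷ [])
    ...   | no ¬ms with (u , v) , uv∈K , ¬m ← find (All.¬All⇒Any¬ (λ (u , v) → (f u Fin.≟ f z) ⊎-dec (f v Fin.≟ f z)) K ¬ms)
               with K′ , q ← ∈⇒↭ uv∈K
               with _ ∷ ds′ ← All-resp-↭ q ds =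
      even ((u , x) ∷ (v , z) ∷ K′)
        (↭-trans (swap u x (swap v z ↭-refl))
          (prep x (↭-trans (swap u z ↭-refl) (↭-trans (prep z (flat-↭ (↭-sym q))) p))))
        ((λ u≡x → ¬m (inj₁ (≡-trans u≡x x≡z))) ∷ (λ v≡z → ¬m (inj₂ v≡z)) ∷ ds′)
    insert x (dominated c K z Z p ls cs) with f x Fin.≟ c
    ... | yes fx≡c = dominated c K x (z ∷ Z) (prep x p) ls (fx≡c ∷ cs)
    -- A term of another value uses up one leftover; nothing is left over only when that was the
    -- last one.
    insert x (dominated c K z [] p ls (fz≡c ∷ [])) | no fx≢c =
      even ((z , x) ∷ K) (↭-trans (swap z x ↭-refl) (prep x p))
        (leads⇒distinct _ (fz≡c , fx≢c) ∷ All.map (leads⇒distinct _) ls)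
    insert x (dominated c K z (z′ ∷ Z) p ls (fz≡c ∷ cs)) | no fx≢c =
      dominated c ((z , x) ∷ K) z′ Z
        (↭-trans (++⁺ˡ (z′ ∷ Z) (swap z x ↭-refl))
          (↭-trans (shift x (z′ ∷ Z) (z ∷ flat K)) (prep x (↭-trans (shift z (z′ ∷ Z) (flat K)) p))))
        ((fz≡c , fx≢c) ∷ ls) cs

    couple : ∀ L → Coupled L
    couple []      = even [] ↭-refl []
    couple (x ∷ L) = insert x (couple L)

    flat-↭-unzip : (K : List (B × B)) → map proj₁ K ++ map proj₂ K ↭ flat K
    flat-↭-unzip []            = ↭-refl
    flat-↭-unzip ((x , y) ∷ K) = prep x (↭-trans (shift y _ _) (prep y (flat-↭-unzip K)))

  Constant : Fin m → List B → Set _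
  Constant c = All (λ x → f x ≡ c)

  -- Parity excludes a single leftover. In the dominated case the leftovers and the first
  -- coordinates all have value `c`, and since there is at least one leftover they are more than
  -- half of all terms.
  coupling : ∀ k L → length L ≡ 2 * k →
    (∃[ K ] flat K ↭ L × All Distinct K × length K ≡ k) ⊎
    (∃[ c ] Selects (λ T → Constant c T × k < length T) L)
  coupling k L |L|≡2k with couple L
  ... | even K p ds = inj₁ (K , p , ds , *-cancelˡ-≡ _ _ 2
    (≡-trans (sym (length-flat K)) (≡-trans (↭-length p) |L|≡2k)))
  ... | odd K z p ds = contradiction
    (≡-trans (cong suc (sym (length-flat K))) (≡-trans (↭-length p) |L|≡2k))
    (odd≢even (length K) k)
  ... | dominated c K z Z p ls cs = inj₂ (c , (z ∷ Z) ++ map proj₁ K , map proj₂ K ,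
    ↭-trans (↭-reflexive (++-assoc (z ∷ Z) _ _)) (↭-trans (++⁺ˡ (z ∷ Z) (flat-↭-unzip K)) p) ,
    All.++⁺ cs (All.map⁺ (All.map proj₁ ls)) , *-cancelˡ-< 2 _ _ long)
    where
    open ≤-Reasoning
    long : 2 * k < 2 * length ((z ∷ Z) ++ map proj₁ K)
    long = begin-strict
      2 * k                                          ≡⟨ |L|≡2k ⟨
      length L                                       ≡⟨ ↭-length p ⟨
      length ((z ∷ Z) ++ flat K)                     ≡⟨ length-++ (z ∷ Z) ⟩
      suc (length Z) + length (flat K)               ≡⟨ cong (suc (length Z) +_) (length-flat K) ⟩
      suc (length Z) + 2 * length K                  <⟨ m<n+m _ (s≤s z≤n) ⟩
      suc (length Z) + (suc (length Z) + 2 * length K)  ≡⟨ double (suc (length Z)) (length K) ⟩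
      2 * (suc (length Z) + length K)                ≡⟨ cong (λ l → 2 * (suc (length Z) + l)) (length-map proj₁ K) ⟨
      2 * (suc (length Z) + length (map proj₁ K))    ≡⟨ cong (2 *_) (length-++ (z ∷ Z)) ⟨
      2 * length ((z ∷ Z) ++ map proj₁ K)            ∎
      where
      double : ∀ a b → a + (a + 2 * b) ≡ 2 * (a + b)
      double = solve-∀

-- Cauchy–Davenport for two-element sets and Erdős–Ginzburg–Ziv

module SumsOfChoices {p : ℕ} (p-prime : Prime p) {B : Set b} (f : B → Fin p) where
  private instance
    p≢0 : NonZero p
    p≢0 = prime⇒nonZero p-prime
  open Residues p
  open PrimeResidues p-prime
  open GroupProperties group using (∙-cancelʳ; //-rightDividesˡ)
  open Coupling f using (Distinct; Constant; coupling)
  open DecMembership (Fin._≟_ {p}) using (_∈?_)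

  ∑ : List B → Fin p
  ∑ T = σ (C p) (map f T)

  ∑-constant : ∀ {c T} → Constant c T → ∑ T ≡ length T · c
  ∑-constant []         = refl
  ∑-constant (eq ∷ eqs) = cong₂ _⊹_ eq (∑-constant eqs)

  HasSum : ℕ → Fin p → List B → Set b
  HasSum k t = Selects (λ T → length T ≡ k × ∑ T ≡ t)

  ChoiceSum : List (B × B) → Fin p → Set b
  ChoiceSum K t = HasSum (length K) t (flat K)

  choose₁ : ∀ x y {K t} → ChoiceSum K t → ChoiceSum ((x , y) ∷ K) (f x ⊹ t)
  choose₁ x y (T , U , T++U↭ , |T| , ∑T) = x ∷ T , y ∷ U ,
    prep x (↭-trans (shift y T U) (prep y T++U↭)) , cong suc |T| , cong (f x ⊹_) ∑T

  choose₂ : ∀ x y {K t} → ChoiceSum K t → ChoiceSum ((x , y) ∷ K) (f y ⊹ t)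
  choose₂ x y choice with T , U , T++U↭ , rest ← choose₁ y x choice =
    T , U , ↭-trans T++U↭ (swap y x ↭-refl) , rest

  some-choice : ∀ K → ∃[ t ] ChoiceSum K t
  some-choice []            = 𝟘 , [] , [] , ↭-refl , refl , refl
  some-choice ((x , y) ∷ K) = _ , choose₁ x y (proj₂ (some-choice K))

  private
    ⊹-⊟ : ∀ x t → x ⊹ (t ⊟ x) ≡ t
    ⊹-⊟ x t = ≡-trans (comm x (t ⊟ x)) (//-rightDividesˡ x t)

  -- The multiples of a nonzero `d` are all residues, so translating `w` repeatedly by `d` reaches
  -- everything.
  shift-closed⇒full : ∀ {d w W} → d ≢ 𝟘 → w ∈ W → (∀ {t} → t ∈ W → d ⊹ t ∈ W) → ∀ t → t ∈ W
  shift-closed⇒full {d} {w} {W} d≢𝟘 w∈W closed t with k , kd≡ ← multiples-cover d≢𝟘 (t ⊟ w) =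
    subst (_∈ W) (≡-trans (cong (_⊹ w) kd≡) (//-rightDividesˡ w t)) (orbit k)
    where
    orbit : ∀ k → k · d ⊹ w ∈ W
    orbit zero    = subst (_∈ W) (sym (identityˡ w)) w∈W
    orbit (suc k) = subst (_∈ W) (sym (assoc d (k · d) w)) (closed (orbit k))

  -- Dual form of the Cauchy–Davenport bound |A₁ + ⋯ + A_k| ≥ min(p, k + 1) for
  -- two-element sets: the sums of choices miss fewer than p - k residues.
  choice-sum-∈ : ∀ K → All Distinct K → ∀ W → Unique W → 1 ≤ length W → p ≤ length W + length K →
                 ∃[ t ] t ∈ W × ChoiceSum K t
  choice-sum-∈ [] [] W uniq _ p≤ =
    𝟘 , unique-full uniq (subst (p ≤_) (+-identityʳ _) p≤) 𝟘 , proj₂ (some-choice [])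
  choice-sum-∈ ((x , y) ∷ K) (fx≢fy ∷ ds) W uniq 1≤ p≤
    with All.all? (λ t → (t ⊟ f y) ∈? map (_⊟ f x) W) W
  -- A residue `t ⊟ f y` outside the translate of `W` by `⊖ f x` enlarges the target set by one,
  -- which pays for the couple removed.
  ... | no ¬all with t , t∈W , t-y∉ ← find (All.¬All⇒Any¬ (λ t → (t ⊟ f y) ∈? map (_⊟ f x) W) W ¬all)
                with choice-sum-∈ K ds ((t ⊟ f y) ∷ map (_⊟ f x) W)
                       (All.¬Any⇒All¬ _ t-y∉ ∷ Unique.map⁺ (∙-cancelʳ _ _ _) uniq) (s≤s z≤n)
                       (subst (p ≤_) (≡-trans (+-suc _ _) (cong (λ l → suc (l + length K)) (sym (length-map _ W)))) p≤)
  ...   | _ , here refl , choice = t , t∈W , subst (ChoiceSum _) (⊹-⊟ (f y) t) (choose₂ x y choice)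
  ...   | _ , there s∈ , choice with s , s∈W , refl ← ∈-map⁻ (_⊟ f x) s∈ =
    s , s∈W , subst (ChoiceSum _) (⊹-⊟ (f x) s) (choose₁ x y choice)
  -- Otherwise `W` is closed under translation by the nonzero `f x ⊟ f y`, hence contains every
  -- residue, and any choice will do.
  choice-sum-∈ ((x , y) ∷ K) (fx≢fy ∷ ds) W@(w ∷ _) uniq _ _ | yes all
    with t , choice ← some-choice ((x , y) ∷ K) =
    t , shift-closed⇒full (fx≢fy ∘ x∙y⁻¹≈ε⇒x≈y _ _) (here refl) closed t , choice
    where
    open GroupProperties group using (x∙y⁻¹≈ε⇒x≈y)
    closed : ∀ {t} → t ∈ W → (f x ⊟ f y) ⊹ t ∈ W
    closed {t} t∈W with s , s∈W , eq ← ∈-map⁻ (_⊟ f x) (All.lookup all t∈W) = subst (_∈ W) (begin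
      s                        ≡⟨ ⊹-⊟ (f x) s ⟨
      f x ⊹ (s ⊟ f x)          ≡⟨ cong (f x ⊹_) eq ⟨
      f x ⊹ (t ⊟ f y)          ≡⟨ cong (f x ⊹_) (comm t (⊖ f y)) ⟩
      f x ⊹ (⊖ f y ⊹ t)        ≡⟨ assoc (f x) (⊖ f y) t ⟨
      (f x ⊟ f y) ⊹ t          ∎) s∈W
      where open ≡-Reasoning

  suc[p∸1] : suc (p ∸ 1) ≡ p
  suc[p∸1] = suc-pred p

  -- A value occurring more than `p ∸ 1` times occurs at least `p` times, and `p` equal residues sum
  -- to zero.
  distinct-coupling : ∀ L → length L ≡ 2 * (p ∸ 1) →
    HasSum p 𝟘 L ⊎ (∃[ K ] flat K ↭ L × All Distinct K × length K ≡ p ∸ 1)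
  distinct-coupling L |L| with coupling (p ∸ 1) L |L|
  ... | inj₁ K = inj₂ K
  ... | inj₂ (c , T , U , T++U↭L , const , long)
    with T₁ , T₂ , T₁++T₂↭T , |T₁|≡p ← splitAt-length p T (subst (_≤ length T) suc[p∸1] long) =
    inj₁ (Selects-⊆ U T++U↭L (T₁ , T₂ , T₁++T₂↭T , |T₁|≡p ,
      ≡-trans (∑-constant (All.++⁻ˡ T₁ (All-resp-↭ (↭-sym T₁++T₂↭T) const)))
        (∣⇒·≡𝟘 c (subst (p ∣_) (sym |T₁|≡p) ∣-refl))))

  -- Among exactly `2p - 1` terms one is set aside and the others are coupled. One member per couple
  -- can be chosen so that the sum cancels the term set aside.
  erdős-ginzburg-ziv : ∀ L → 2 * p ≤ suc (length L) → HasSum p 𝟘 L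
  erdős-ginzburg-ziv L long
    with T , U , T++U↭L , |T| ← splitAt-length (suc (2 * (p ∸ 1))) L
           (s≤s⁻¹ (subst (_≤ suc (length L)) (≡-trans (cong (2 *_) (sym suc[p∸1])) (*-suc 2 (p ∸ 1))) long))
    = Selects-⊆ U T++U↭L (exact T |T|)
    where
    exact : ∀ T → length T ≡ suc (2 * (p ∸ 1)) → HasSum p 𝟘 T
    exact (x ∷ L) |L| with distinct-coupling L (suc-injective |L|)
    ... | inj₁ zs = Selects-⊆ (x ∷ []) (++-comm L (x ∷ [])) zs
    ... | inj₂ (K , flatK↭L , ds , |K|)
      -- The target set is the singleton `⊖ f x`: one residue and `p - 1` couples meet the bound `p`
      -- exactly.
      with _ , here refl , T , U , T++U↭ , |T| , ∑T ← choice-sum-∈ K ds (⊖ f x ∷ []) ([] ∷ []) (s≤s z≤n)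
             (≤-reflexive (sym (≡-trans (cong suc |K|) suc[p∸1])))
      = x ∷ T , U , prep x (↭-trans T++U↭ flatK↭L) ,
        ≡-trans (cong suc (≡-trans |T| |K|)) suc[p∸1] ,
        ≡-trans (cong (f x ⊹_) ∑T) (inverseʳ (f x))

-- Affine planes in elementary abelian 2-groups

_≟ᵥ_ : ∀ {n} (u v : Vec Bool n) → Dec (u ≡ v)
_≟ᵥ_ = ≡-dec Bool._≟_

_⊻_ : ∀ {n} → Vec Bool n → Vec Bool n → Vec Bool n
_⊻_ = zipWith _xor_

⊻≡0⇒≡ : ∀ {n} (u v : Vec Bool n) → u ⊻ v ≡ replicate n false → u ≡ v
⊻≡0⇒≡ []      []      _  = refl
⊻≡0⇒≡ (x ∷ u) (y ∷ v) eq = cong₂ _∷_ (xor≡false⇒≡ x y (cong Vec.head eq)) (⊻≡0⇒≡ u v (cong Vec.tail eq))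
  where
  xor≡false⇒≡ : ∀ x y → x xor y ≡ false → x ≡ y
  xor≡false⇒≡ false false _ = refl
  xor≡false⇒≡ true  true  _ = refl

bools² : List (Vec Bool 2)
bools² = (false ∷ false ∷ []) ∷ (false ∷ true ∷ []) ∷ (true ∷ false ∷ []) ∷ (true ∷ true ∷ []) ∷ []

∈-bools² : ∀ u → u ∈ bools²
∈-bools² (false ∷ false ∷ []) = here refl
∈-bools² (false ∷ true  ∷ []) = there (here refl)
∈-bools² (true  ∷ false ∷ []) = there (there (here refl))
∈-bools² (true  ∷ true  ∷ []) = there (there (there (here refl)))

HasExponent2 : AbelianGroup c ℓ → Set _
HasExponent2 V = ∀ x → x ∙ x ≈ ε
  where open AbelianGroup V

module TwoTorsion (V : AbelianGroup c ℓ) (x∙x≈ε : HasExponent2 V) where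
  private module V = AbelianGroup V
  open V using (Carrier; _≈_; _∙_; ε; ∙-cong; ∙-congˡ; ∙-congʳ; identityˡ; identityʳ; assoc)
  open GroupProperties V.group using (∙-cancelˡ; ∙-cancelʳ)
  open ≈-Reasoning V.setoid

  private
    medial : ∀ w x y z → (w ∙ x) ∙ (y ∙ z) ≈ (w ∙ y) ∙ (x ∙ z)
    medial = interchange V.commutativeSemigroup

  x∙y≈ε⇒x≈y : ∀ {x y} → x ∙ y ≈ ε → x ≈ y
  x∙y≈ε⇒x≈y {x} {y} xy≈ε = ∙-cancelʳ y x y (V.trans xy≈ε (V.sym (x∙x≈ε y)))

  x∙xy≈y : ∀ x y → x ∙ (x ∙ y) ≈ y
  x∙xy≈y x y = V.trans (V.sym (assoc x x y)) (V.trans (∙-congʳ (x∙x≈ε x)) (identityˡ y))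

  scale : Bool → Carrier → Carrier
  scale b x = if b then x else ε

  scale-xor : ∀ b c x → scale b x ∙ scale c x ≈ scale (b xor c) x
  scale-xor false c     x = identityˡ _
  scale-xor true  false x = identityʳ x
  scale-xor true  true  x = x∙x≈ε x

  -- Linear combinations over the field of two elements: Booleans are the scalars and `_⊻_` adds
  -- coefficient vectors.
  comb : ∀ {n} → Vec Carrier n → Vec Bool n → Carrier
  comb []       []       = ε
  comb (x ∷ xs) (b ∷ bs) = scale b x ∙ comb xs bs

  comb-⊻ : ∀ {n} (xs : Vec Carrier n) u v → comb xs u ∙ comb xs v ≈ comb xs (u ⊻ v)
  comb-⊻ []       []      []      = identityˡ ε
  comb-⊻ (x ∷ xs) (b ∷ u) (c ∷ v) =
    V.trans (medial _ _ _ _) (∙-cong (scale-xor b c x) (comb-⊻ xs u v))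

  Independent : ∀ {n} → Vec Carrier n → Set _
  Independent {n} xs = ∀ u → comb xs u ≈ ε → u ≡ replicate n false

  -- In characteristic 2 a relation that involves `x` exhibits `x` itself as a combination of the
  -- others.
  independent-∷ : ∀ {n} {x} {xs : Vec Carrier n} → (∀ u → ¬ x ≈ comb xs u) →
                  Independent xs → Independent (x ∷ xs)
  independent-∷ x∉ indep (true  ∷ u) eq = contradiction (x∙y≈ε⇒x≈y eq) (x∉ u)
  independent-∷ x∉ indep (false ∷ u) eq = cong (false ∷_) (indep u (V.trans (V.sym (identityˡ _)) eq))

  module AffineFrame {n} (o : Carrier) (xs : Vec Carrier n) where
    point : Vec Bool n → Carrier
    point u = o ∙ comb xs u

    -- The two copies of the base point cancel.
    point-sum : ∀ u v → point u ∙ point v ≈ comb xs (u ⊻ v)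
    point-sum u v = begin
      (o ∙ comb xs u) ∙ (o ∙ comb xs v)   ≈⟨ medial _ _ _ _ ⟩
      (o ∙ o) ∙ (comb xs u ∙ comb xs v)   ≈⟨ ∙-cong (x∙x≈ε o) (comb-⊻ xs u v) ⟩
      ε ∙ comb xs (u ⊻ v)                 ≈⟨ identityˡ _ ⟩
      comb xs (u ⊻ v)                     ∎

    point-injective : Independent xs → ∀ {u v} → point u ≈ point v → u ≡ v
    point-injective indep {u} {v} eq = ⊻≡0⇒≡ u v (indep (u ⊻ v) (begin
      comb xs (u ⊻ v)             ≈⟨ comb-⊻ xs u v ⟨
      comb xs u ∙ comb xs v       ≈⟨ ∙-congʳ (∙-cancelˡ o _ _ eq) ⟩
      comb xs v ∙ comb xs v       ≈⟨ x∙x≈ε _ ⟩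
      ε                           ∎))

  independent-[] : Independent []
  independent-[] [] _ = refl

  module Planes {N : ℕ} (code : Inverse V.setoid (setoid (Fin N))) (5≤N : 5 ≤ N)
                {X : Set a} (cls : X → Carrier) (R : List X) where
    open Inverse code using (to; from; to-cong; strictlyInverseˡ; strictlyInverseʳ)
    κ : X → Fin N
    κ = to ∘ cls

    to-injective : ∀ {u v} → to u ≡ to v → u ≈ v
    to-injective {u} {v} eq = begin
      u             ≈⟨ strictlyInverseʳ u ⟨
      from (to u)   ≡⟨ cong from eq ⟩
      from (to v)   ≈⟨ strictlyInverseʳ v ⟩
      v             ∎

    -- When the classes on `R` are distinct, four of them with zero sum are precisely the points of
    -- an affine plane over the field of two elements.
    Plane : List X → Set _
    Plane q = (∃[ R′ ] q ++ R′ ↭ R) × length q ≡ 4 × σ V (map cls q) ≈ ε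

    -- The seven points of an affine 3-space through o other than o itself, written
    -- as x, y and the remaining five; each plane listed avoids o.
    record TwoPointPlanes (x y : X) : Set (a Level.⊔ ℓ) where
      field
        {z x⊹y x⊹z y⊹z x⊹y⊹z} : X
        planeˣ  : Plane (x⊹y ∷ x⊹y⊹z ∷ x ∷ x⊹z ∷ [])
        planeˣ′ : Plane (z ∷ x⊹y ∷ x ∷ y⊹z ∷ [])
        planeʸ  : Plane (x⊹y ∷ x⊹y⊹z ∷ y ∷ y⊹z ∷ [])
        planeʸ′ : Plane (z ∷ x⊹y ∷ y ∷ x⊹z ∷ [])

    module _ (distinct : Unique (map κ R)) (|R| : suc (length R) ≡ N) where
      private
        missing : ∃[ i ] i ∉ map κ R
        missing = fin-missing (map κ R) (≤-reflexive (≡-trans (cong suc (length-map κ R)) |R|))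

      omitted : Fin N
      omitted = proj₁ missing

      omitted∉ : omitted ∉ map κ R
      omitted∉ = proj₂ missing

      -- The `N - 1` distinct classes of `R` together with the omitted one are `N` distinct elements
      -- of `Fin N`.
      represented : ∀ {i} → i ≢ omitted → ∃[ z ] z ∈ R × κ z ≡ i
      represented {i} i≢omitted
        with Any.tail i≢omitted (unique-full (All.¬Any⇒All¬ _ (omitted∉) ∷ distinct)
               (≤-reflexive (≡-trans (sym |R|) (cong suc (sym (length-map κ R))))) i)
      ... | i∈ with z , z∈R , i≡ ← ∈-map⁻ κ i∈ = z , z∈R , sym i≡

      κ≢omitted : ∀ {x} → x ∈ R → κ x ≢ omitted
      κ≢omitted x∈R eq = omitted∉ (subst (_∈ map κ R) eq (∈-map⁺ κ x∈R))

      -- The omitted class is the origin `o` of an affine frame. Two directions lead to `x` and `y`,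
      -- the third lies outside their span, and every point of the resulting 3-space except `o` is
      -- the class of a term of `R`.
      twoPointPlanes : ∀ {x y} → x ∈ R → y ∈ R → κ x ≢ κ y → TwoPointPlanes x y
      twoPointPlanes {x} {y} x∈R y∈R κx≢κy = record
        { planeˣ  = plane (at₁₁₀ ∷ at₁₁₁ ∷ atˣ   ∷ at₁₀₁ ∷ [])
        ; planeˣ′ = plane (at₀₀₁ ∷ at₁₁₀ ∷ atˣ   ∷ at₀₁₁ ∷ [])
        ; planeʸ  = plane (at₁₁₀ ∷ at₁₁₁ ∷ atʸ   ∷ at₀₁₁ ∷ [])
        ; planeʸ′ = plane (at₀₀₁ ∷ at₁₁₀ ∷ atʸ   ∷ at₁₀₁ ∷ [])
        }
        where
        o = from omitted
        x̂ = o ∙ cls x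
        ŷ = o ∙ cls y

        ô≉ : ∀ {x} → x ∈ R → ¬ o ∙ cls x ≈ ε
        ô≉ {x} x∈R eq = κ≢omitted x∈R (≡-trans (to-cong (V.sym (x∙y≈ε⇒x≈y eq))) (strictlyInverseˡ omitted))

        indep₂ : Independent (ŷ ∷ x̂ ∷ [])
        indep₂ = independent-∷ ŷ∉ (independent-∷ x̂∉ independent-[])
          where
          x̂∉ : ∀ u → ¬ x̂ ≈ comb [] u
          x̂∉ [] = ô≉ x∈R
          ŷ∉ : ∀ u → ¬ ŷ ≈ comb (x̂ ∷ []) u
          ŷ∉ (false ∷ []) eq = ô≉ y∈R (V.trans eq (identityˡ ε))
          ŷ∉ (true  ∷ []) eq = κx≢κy (sym (to-cong (∙-cancelˡ o _ _ (V.trans eq (identityʳ _)))))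

        -- The span of `x̂` and `ŷ` has only four elements, so `5 ≤ N` leaves room for a third
        -- direction.
        outside : ∃[ i ] i ∉ map (to ∘ comb (ŷ ∷ x̂ ∷ [])) bools²
        outside = fin-missing (map (to ∘ comb (ŷ ∷ x̂ ∷ [])) bools²) 5≤N
        ẑ = from (proj₁ outside)

        indep₃ : Independent (ẑ ∷ ŷ ∷ x̂ ∷ [])
        indep₃ = independent-∷ ẑ∉ indep₂
          where
          ẑ∉ : ∀ u → ¬ ẑ ≈ comb (ŷ ∷ x̂ ∷ []) u
          ẑ∉ u eq = proj₂ outside (subst (_∈ map (to ∘ comb (ŷ ∷ x̂ ∷ [])) bools²)
            (≡-trans (to-cong (V.sym eq)) (strictlyInverseˡ _)) (∈-map⁺ (to ∘ comb (ŷ ∷ x̂ ∷ [])) (∈-bools² u)))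

        frame = ẑ ∷ ŷ ∷ x̂ ∷ []
        open AffineFrame o frame

        record At (u : Vec Bool 3) (z : X) : Set (a Level.⊔ ℓ) where
          constructor _,ₐ_
          pattern
          field
            member   : z ∈ R
            position : cls z ≈ point u

        at : ∀ u → {False (u ≟ᵥ replicate 3 false)} → ∃[ z ] At u z
        at u {u≢0} = let z , z∈R , κz≡ = represented {to (point u)} ≢omitted in z , (z∈R ,ₐ to-injective κz≡)
          where
          ≢omitted : to (point u) ≢ omitted
          ≢omitted eq = toWitnessFalse u≢0 (indep₃ u (∙-cancelˡ o _ _ (begin
            point u   ≈⟨ to-injective (≡-trans eq (sym (strictlyInverseˡ omitted))) ⟩
            o         ≈⟨ identityʳ o ⟨
            o ∙ ε     ∎)))

        atˣ : At (false ∷ false ∷ true ∷ []) x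
        atˣ = x∈R ,ₐ V.sym (begin
          o ∙ (ε ∙ (ε ∙ (x̂ ∙ ε)))   ≈⟨ ∙-congˡ (V.trans (identityˡ _) (V.trans (identityˡ _) (identityʳ x̂))) ⟩
          o ∙ x̂                     ≈⟨ x∙xy≈y o (cls x) ⟩
          cls x                     ∎)

        atʸ : At (false ∷ true ∷ false ∷ []) y
        atʸ = y∈R ,ₐ V.sym (begin
          o ∙ (ε ∙ (ŷ ∙ (ε ∙ ε)))   ≈⟨ ∙-congˡ (V.trans (identityˡ _) (V.trans (∙-congˡ (identityˡ ε)) (identityʳ ŷ))) ⟩
          o ∙ ŷ                     ≈⟨ x∙xy≈y o (cls y) ⟩
          cls y                     ∎)

        -- Subscripts give the coordinates in the order x, y, z, the reverse of their order in
        -- `frame`.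
        at₀₀₁ = proj₂ (at (true ∷ false ∷ false ∷ []))
        at₁₁₀ = proj₂ (at (false ∷ true ∷ true ∷ []))
        at₁₀₁ = proj₂ (at (true ∷ false ∷ true ∷ []))
        at₀₁₁ = proj₂ (at (true ∷ true ∷ false ∷ []))
        at₁₁₁ = proj₂ (at (true ∷ true ∷ true ∷ []))

        unique-points : ∀ {us zs} → Pointwise At us zs → Unique us → Unique zs
        unique-points []         []           = []
        unique-points {u ∷ _} {z ∷ _} ((_ ,ₐ z≈) ∷ ats) (u∉ ∷ uniq) = fresh ats u∉ ∷ unique-points ats uniq
          where
          fresh : ∀ {vs ws} → Pointwise At vs ws → All (u ≢_) vs → All (z ≢_) ws
          fresh []                []          = []
          fresh ((_ ,ₐ w≈) ∷ ats) (u≢v ∷ u∉) =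
            (λ { refl → u≢v (point-injective indep₃ (V.trans (V.sym z≈) w≈)) }) ∷ fresh ats u∉

        members : ∀ {us zs} → Pointwise At us zs → All (_∈ R) zs
        members []               = []
        members ((z∈ ,ₐ _) ∷ ats) = z∈ ∷ members ats

        -- The base point and the directions cancel once `t ⊻ u` equals `v ⊻ w`. This equation and
        -- the distinctness of the coordinates are decided by evaluation at each use.
        plane : ∀ {t u v w z₁ z₂ z₃ z₄} (let us = t ∷ u ∷ v ∷ w ∷ []) →
                Pointwise At us (z₁ ∷ z₂ ∷ z₃ ∷ z₄ ∷ []) →
                {True (unique? _≟ᵥ_ us)} → {True ((t ⊻ u) ≟ᵥ (v ⊻ w))} →
                Plane (z₁ ∷ z₂ ∷ z₃ ∷ z₄ ∷ [])
        plane {t} {u} {v} {w} {z₁} {z₂} {z₃} {z₄} ats@((_ ,ₐ z₁≈) ∷ (_ ,ₐ z₂≈) ∷ (_ ,ₐ z₃≈) ∷ (_ ,ₐ z₄≈) ∷ []) {distinct-points} {sum≡0}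
          with R′ , R↭ ← unique-⊆⇒↭ (unique-points ats (toWitness distinct-points)) (members ats)
          = (R′ , ↭-sym R↭) , refl , (begin
            cls z₁ ∙ (cls z₂ ∙ (cls z₃ ∙ (cls z₄ ∙ ε)))   ≈⟨ ∙-congˡ (∙-congˡ (∙-congˡ (identityʳ _))) ⟩
            cls z₁ ∙ (cls z₂ ∙ (cls z₃ ∙ cls z₄))         ≈⟨ assoc _ _ _ ⟨
            (cls z₁ ∙ cls z₂) ∙ (cls z₃ ∙ cls z₄)         ≈⟨ ∙-cong (∙-cong z₁≈ z₂≈) (∙-cong z₃≈ z₄≈) ⟩
            (point t ∙ point u) ∙ (point v ∙ point w)     ≈⟨ ∙-cong (point-sum t u) (point-sum v w) ⟩
            comb frame (t ⊻ u) ∙ comb frame (v ⊻ w)               ≡⟨ cong (λ s → comb frame s ∙ comb frame (v ⊻ w)) (toWitness sum≡0) ⟩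
            comb frame (v ⊻ w) ∙ comb frame (v ⊻ w)               ≈⟨ x∙x≈ε _ ⟩
            ε                                             ∎)

-- The prime case

module _ {G : AbelianGroup c ℓ} {X : Set a} where
  private module G = AbelianGroup G
  open G using (_≈_)

  σ-cong-constant : (h : X → G.Carrier) {v : G.Carrier} {xs ys : List X} → length xs ≡ length ys →
    All (λ x → h x ≈ v) xs → All (λ x → h x ≈ v) ys → σ G (map h xs) ≈ σ G (map h ys)
  σ-cong-constant h {xs = []}    {[]}    eq []       []       = G.refl
  σ-cong-constant h {xs = _ ∷ _} {_ ∷ _} eq (e ∷ es) (d ∷ ds) =
    G.∙-cong (G.trans e (G.sym d)) (σ-cong-constant h (suc-injective eq) es ds)

+-≤-tight : ∀ {a b c d} → a ≤ b → c ≤ d → a + c ≡ b + d → a ≡ b × c ≡ d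
+-≤-tight {a} {b} {c} {d} a≤b c≤d eq = a≡b , +-cancelˡ-≡ a c d (≡-trans eq (cong (_+ d) (sym a≡b)))
  where
  a≡b : a ≡ b
  a≡b = ≤-antisym a≤b (+-cancelʳ-≤ d b a (subst (_≤ a + d) eq (+-monoʳ-≤ a c≤d)))

∈-flat⁻ : {A : Set a} {x : A} → ∀ ps → x ∈ flat ps → ∃[ y ] ((x , y) ∈ ps ⊎ (y , x) ∈ ps)
∈-flat⁻ ((_ , y) ∷ ps) (here refl)         = y , inj₁ (here refl)
∈-flat⁻ ((x , _) ∷ ps) (there (here refl)) = x , inj₂ (here refl)
∈-flat⁻ (_ ∷ ps)       (there (there x∈)) with ∈-flat⁻ ps x∈
... | y , inj₁ xy∈ = y , inj₁ (there xy∈)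
... | y , inj₂ yx∈ = y , inj₂ (there yx∈)

nonempty : {xs : List A} → 1 ≤ length xs → ∃[ x ] x ∈ xs
nonempty {xs = x ∷ _} _ = x , here refl

unique-map-injective : {A : Set a} {B : Set b} (h : A → B) {xs : List A} → Unique (map h xs) →
  ∀ {x y} → x ∈ xs → y ∈ xs → h x ≡ h y → x ≡ y
unique-map-injective h _          (here refl) (here refl) _  = refl
unique-map-injective h (x∉ ∷ _)   (here refl) (there y∈)  eq = contradiction eq (All.lookup x∉ (∈-map⁺ h y∈))
unique-map-injective h (y∉ ∷ _)   (there x∈)  (here refl) eq = contradiction (sym eq) (All.lookup y∉ (∈-map⁺ h x∈))
unique-map-injective h (_ ∷ uniq) (there x∈)  (there y∈)  eq = unique-map-injective h uniq x∈ y∈ eq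

module PrimeCase
  (V : AbelianGroup c ℓ)
  (x∙x≈ε : HasExponent2 V)
  {N : ℕ} (code : Inverse (AbelianGroup.setoid V) (setoid (Fin N))) (5≤N : 5 ≤ N)
  {p : ℕ} (p-prime : Prime p) (3≤p : 3 ≤ p)
  {X : Set a} (cls : X → AbelianGroup.Carrier V) (f : X → Fin p)
  where
  private
    module V = AbelianGroup V
    instance
      p≢0 : NonZero p
      p≢0 = prime⇒nonZero p-prime
  open V using (_≈_; _∙_; ε)
  open TwoTorsion V x∙x≈ε
  open Residues p
  open GroupProperties group using (∙-cancelˡ; ∙-cancelʳ; ⁻¹-injective)
  open PrimeResidues p-prime using (double-injective)
  module F = SumsOfChoices p-prime f
  open F using (∑; suc[p∸1])

  κ : X → Fin N
  κ x = Inverse.to code (cls x)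

  cls-≈ : ∀ {x y} → κ x ≡ κ y → cls x ≈ cls y
  cls-≈ = Planes.to-injective code 5≤N cls []

  σᵛ : List X → V.Carrier
  σᵛ T = σ V (map cls T)

  Good : List X → Set _
  Good = Selects (λ T → length T ≡ 2 * p × σᵛ T ≈ ε × ∑ T ≡ 𝟘)

  Matched : X × X → Set
  Matched (x , y) = κ x ≡ κ y

  g : X × X → Fin p
  g (x , y) = f x ⊹ f y

  module G = SumsOfChoices p-prime g
  open Coupling g using (Distinct)

  σᵛ-flat : ∀ {P} → All Matched P → σᵛ (flat P) ≈ ε
  σᵛ-flat []                = V.refl
  σᵛ-flat {(x , y) ∷ P} (x~y ∷ ms) = begin
    cls x ∙ (cls y ∙ σᵛ (flat P))   ≈⟨ V.assoc _ _ _ ⟨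
    (cls x ∙ cls y) ∙ σᵛ (flat P)   ≈⟨ V.∙-cong (V.trans (V.∙-congʳ (cls-≈ x~y)) (x∙x≈ε _)) (σᵛ-flat ms) ⟩
    ε ∙ ε                           ≈⟨ V.identityˡ ε ⟩
    ε                               ∎
    where open ≈-Reasoning V.setoid

  ∑-flat : ∀ P → ∑ (flat P) ≡ G.∑ P
  ∑-flat []            = refl
  ∑-flat ((x , y) ∷ P) = ≡-trans (sym (assoc (f x) (f y) _)) (cong (g (x , y) ⊹_) (∑-flat P))

  module Failure (S : List X) (bad : ¬ Good S) (|S| : 5 + length S ≡ 4 * p + N) where

    -- The two counts are exact because a sequence without a good sublist attains both bounds.
    record Pairing : Set a where
      field
        pairs     : List (X × X)
        rest      : List X
        split     : flat pairs ++ rest ↭ S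
        matched   : All Matched pairs
        distinct  : Unique (map κ rest)
        |pairs|   : length pairs ≡ 2 * (p ∸ 1)
        |rest|    : suc (length rest) ≡ N

    -- Matched pairs have zero class sum, so they may be joined to any `q` with zero class sum; a
    -- vanishing value sum would then yield a good sublist of `S`.
    not-both : ∀ {P R T U q R′} → flat P ++ R ↭ S → All Matched P → T ++ U ↭ P → q ++ R′ ↭ R →
               2 * length T + length q ≡ 2 * p → σᵛ q ≈ ε → G.∑ T ⊹ ∑ q ≢ 𝟘
    not-both {P} {R} {T} {U} {q} {R′} split ms T++U↭P q++R′↭R len σq ∑≡𝟘 = bad
      (flat T ++ q , flat U ++ R′ , regroup ,
       ≡-trans (length-++ (flat T)) (≡-trans (cong (_+ length q) (length-flat T)) len) ,
       V.trans (σ-map-++ V cls (flat T) q)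
         (V.trans (V.∙-cong (σᵛ-flat (All.++⁻ˡ T (All-resp-↭ (↭-sym T++U↭P) ms))) σq) (V.identityˡ ε)) ,
       ≡-trans (σ-map-++ (C p) f (flat T) q) (≡-trans (cong (_⊹ ∑ q) (∑-flat T)) ∑≡𝟘))
      where
      open PermutationReasoning
      regroup : (flat T ++ q) ++ (flat U ++ R′) ↭ S
      regroup = begin
        (flat T ++ q) ++ (flat U ++ R′)   ≡⟨ ++-assoc (flat T) q _ ⟩
        flat T ++ q ++ flat U ++ R′       ≡⟨ cong (flat T ++_) (++-assoc q (flat U) R′) ⟨
        flat T ++ (q ++ flat U) ++ R′     ↭⟨ ++⁺ˡ (flat T) (++⁺ʳ R′ (++-comm q (flat U))) ⟩
        flat T ++ (flat U ++ q) ++ R′     ≡⟨ cong (flat T ++_) (++-assoc (flat U) q R′) ⟩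
        flat T ++ flat U ++ q ++ R′       ≡⟨ ++-assoc (flat T) (flat U) _ ⟨
        (flat T ++ flat U) ++ (q ++ R′)   ≡⟨ cong (_++ (q ++ R′)) (flat-++ T U) ⟨
        flat (T ++ U) ++ (q ++ R′)        ↭⟨ ++⁺ (flat-↭ T++U↭P) q++R′↭R ⟩
        flat P ++ R                       ↭⟨ split ⟩
        S                                 ∎

    no-zero-pairs : ∀ {P R} → flat P ++ R ↭ S → All Matched P → ¬ G.HasSum p 𝟘 P
    no-zero-pairs split ms (T , U , T++U↭P , |T| , ∑T) =
      not-both {T = T} {U = U} {q = []} split ms T++U↭P ↭-refl
        (≡-trans (+-identityʳ _) (cong (2 *_) |T|)) V.refl (≡-trans (identityʳ (G.∑ T)) ∑T)

    private
      Greedy : List X → Set a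
      Greedy L = ∃[ P ] ∃[ R ] flat P ++ R ↭ L × All Matched P × Unique (map κ R)

      greedy : ∀ L → Greedy L
      greedy []      = [] , [] , ↭-refl , [] , []
      greedy (x ∷ L) with P , R , split , ms , uniq ← greedy L
                     with DecMembership._∈?_ Fin._≟_ (κ x) (map κ R)
      ... | no  κx∉ = P , x ∷ R , ↭-trans (shift x (flat P) R) (prep x split) , ms , All.¬Any⇒All¬ _ κx∉ ∷ uniq
      ... | yes κx∈ with z , z∈R , x~z ← ∈-map⁻ κ κx∈
                    with R′ , R↭ ← ∈⇒↭ z∈R
                    with _ ∷ uniq′ ← Unique-resp-↭ (↭-map⁺ κ R↭) uniq =
        (x , z) ∷ P , R′ ,
        prep x (↭-trans (↭-sym (shift z (flat P) R′)) (↭-trans (++⁺ˡ (flat P) (↭-sym R↭)) split)) ,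
        x~z ∷ ms , uniq′

    -- Erdős-Ginzburg-Ziv for the pair sums gives at most `2p - 2` pairs, and distinctness gives at
    -- most `N` unpaired terms. Since `2|P| + |R| = 4p + N - 5`, parity rules out `|R| = N`, and
    -- then both bounds must be attained.
    pairing : Pairing
    pairing with P , R , split , ms , uniq ← greedy S = record
      { pairs = P ; rest = R ; split = split ; matched = ms ; distinct = uniq
      ; |pairs| = *-cancelˡ-≡ _ _ 2 (proj₁ tight)
      ; |rest| = proj₂ tight
      }
      where
      k = p ∸ 1

      |P|≤ : length P ≤ 2 * k
      |P|≤ = s≤s⁻¹ (s≤s⁻¹ (subst (2 + length P ≤_) (≡-trans (cong (2 *_) (sym suc[p∸1])) (*-suc 2 k))
        (≰⇒> λ long → no-zero-pairs split ms (G.erdős-ginzburg-ziv P long))))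

      |R|≤ : length R ≤ N
      |R|≤ = subst (_≤ N) (length-map κ R) (unique-length uniq)

      balance : suc (2 * length P + length R) ≡ 2 * (2 * k) + N
      balance = +-cancelˡ-≡ 4 _ _ (begin
        4 + suc (2 * length P + length R)      ≡⟨ +-suc 4 _ ⟩
        5 + (2 * length P + length R)          ≡⟨ cong (λ l → 5 + (l + length R)) (length-flat P) ⟨
        5 + (length (flat P) + length R)       ≡⟨ cong (5 +_) (length-++ (flat P)) ⟨
        5 + length (flat P ++ R)               ≡⟨ cong (5 +_) (↭-length split) ⟩
        5 + length S                           ≡⟨ |S| ⟩
        4 * p + N                              ≡⟨ cong (λ j → 4 * j + N) suc[p∸1] ⟨
        4 * suc k + N                          ≡⟨ expand k N ⟩
        4 + (2 * (2 * k) + N)                  ∎)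
        where
        open ≡-Reasoning
        expand : ∀ k N → 4 * suc k + N ≡ 4 + (2 * (2 * k) + N)
        expand = solve-∀

      |R|≢N : length R ≢ N
      |R|≢N refl = odd≢even (length P) (2 * k) (+-cancelʳ-≡ (length R) _ _ balance)

      tight : 2 * length P ≡ 2 * (2 * k) × suc (length R) ≡ N
      tight = +-≤-tight (*-monoʳ-≤ 2 |P|≤) (≤∧≢⇒< |R|≤ |R|≢N) (≡-trans (+-suc _ _) balance)

    module _ (π : Pairing) where
      open Pairing π
      open Planes code 5≤N cls rest using (Plane; TwoPointPlanes; twoPointPlanes)

      couples : ∃[ K ] flat K ↭ pairs × All Distinct K × length K ≡ p ∸ 1
      couples with G.distinct-coupling pairs |pairs|
      ... | inj₁ zs = contradiction zs (no-zero-pairs split matched)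
      ... | inj₂ K  = K

      module _ {K s s′ K′} (flatK↭ : flat K ↭ pairs) (ds : All Distinct K) (|K| : length K ≡ p ∸ 1)
               (K↭ : K ↭ (s , s′) ∷ K′) where

        private
          2+|K′| : 2 + length K′ ≡ p
          2+|K′| = ≡-trans (cong suc (≡-trans (sym (↭-length K↭)) |K|)) suc[p∸1]

          len : 2 * length K′ + 4 ≡ 2 * p
          len = ≡-trans (factor (length K′)) (cong (2 *_) 2+|K′|)
            where
            factor : ∀ k → 2 * k + 4 ≡ 2 * (2 + k)
            factor = solve-∀

        -- The choices from the other p - 2 couples miss at most one residue, so the two
        -- four-element completions q and s ∪ s′ must have the same sum.
        plane-sum : ∀ {q} → Plane q → ∑ q ≡ g s ⊹ g s′
        plane-sum {q} ((R′ , q++R′↭) , |q| , σq) with ∑ q Fin.≟ g s ⊹ g s′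
        ... | yes eq = eq
        ... | no neq with G.choice-sum-∈ K′ (All.tail (All-resp-↭ K↭ ds)) (⊖ ∑ q ∷ ⊖ (g s ⊹ g s′) ∷ [])
                            (((λ eq → neq (⁻¹-injective eq)) ∷ []) ∷ [] ∷ []) (s≤s z≤n)
                            (≤-reflexive (sym 2+|K′|))
        ...   | _ , t∈ , T , U , T++U↭ , |T| , ∑T = contradiction t∈ λ
          { (here refl) → not-both {T = T} {U = U ++ s ∷ s′ ∷ []} {q = q} {R′ = R′} split matched
              (begin
                T ++ U ++ s ∷ s′ ∷ []     ≡⟨ ++-assoc T U _ ⟨
                (T ++ U) ++ s ∷ s′ ∷ []   ↭⟨ ++-comm (T ++ U) _ ⟩
                s ∷ s′ ∷ T ++ U           ↭⟨ s∷s′∷T++U↭ ⟩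
                pairs                     ∎)
              q++R′↭
              (≡-trans (cong₂ (λ a b → 2 * a + b) |T| |q|) len)
              σq (≡-trans (cong (_⊹ ∑ q) ∑T) (inverseˡ (∑ q)))
          ; (there (here refl)) → not-both {T = s ∷ s′ ∷ T} {U = U} {q = []} split matched s∷s′∷T++U↭ ↭-refl
              (≡-trans (+-identityʳ _) (cong (2 *_) (≡-trans (cong (2 +_) |T|) 2+|K′|)))
              V.refl
              (≡-trans (identityʳ _) (≡-trans (sym (assoc (g s) (g s′) _))
                (≡-trans (cong (g s ⊹ g s′ ⊹_) ∑T) (inverseʳ (g s ⊹ g s′)))))
          }
          where
          open PermutationReasoning
          s∷s′∷T++U↭ : s ∷ s′ ∷ T ++ U ↭ pairs
          s∷s′∷T++U↭ = ↭-trans (prep s (prep s′ T++U↭)) (↭-trans (flat-↭ (↭-sym K↭)) flatK↭)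

      -- Every pair lies in some couple, and that couple can be taken as the one withheld from the
      -- choices.
      partner : ∀ {s} → s ∈ pairs → ∃[ s′ ] g s ≢ g s′ × (∀ {q} → Plane q → ∑ q ≡ g s ⊹ g s′)
      partner {s} s∈ with K , flatK↭ , ds , |K| ← couples
                     with ∈-flat⁻ K (∈-resp-↭ (↭-sym flatK↭) s∈)
      ... | s′ , inj₁ ss′∈ with _ , K↭ ← ∈⇒↭ ss′∈ =
        s′ , All.lookup ds ss′∈ , plane-sum flatK↭ ds |K| K↭
      ... | s′ , inj₂ s′s∈ with _ , K↭ ← ∈⇒↭ s′s∈ =
        s′ , (All.lookup ds s′s∈ ∘ sym) , λ pl → ≡-trans (plane-sum flatK↭ ds |K| K↭ pl) (comm (g s′) (g s))

      plane-sum-constant : ∀ {q q′} → Plane q → Plane q′ → ∑ q ≡ ∑ q′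
      plane-sum-constant pl pl′
        with _ , s∈ ← nonempty (subst (1 ≤_) (sym |pairs|) (m≤n⇒m≤o*n 2 (m<n⇒0<n∸m {1} (≤-trans (s≤s (s≤s z≤n)) 3≤p))))
        with _ , _ , sum-fixed ← partner s∈ = ≡-trans (sum-fixed pl) (sym (sum-fixed pl′))

      -- Planes sharing two terms give `f x ⊹ f x⊹z ≡ f y ⊹ f y⊹z` and `f x ⊹ f y⊹z ≡ f y ⊹ f x⊹z`.
      -- Adding these and cancelling leaves twice `f x` equal to twice `f y`.
      constant : ∀ {x y} → x ∈ rest → y ∈ rest → f x ≡ f y
      constant {x} {y} x∈ y∈ with κ x Fin.≟ κ y
      ... | yes x~y = cong f (unique-map-injective κ distinct x∈ y∈ x~y)
      ... | no  x≁y = double-injective 3≤p (∙-cancelʳ (f y⊹z ⊹ f x⊹z) _ _ (begin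
          (f x ⊹ f x) ⊹ (f y⊹z ⊹ f x⊹z)     ≡⟨ interchange commutativeSemigroup (f x) (f x) (f y⊹z) (f x⊹z) ⟩
          (f x ⊹ f y⊹z) ⊹ (f x ⊹ f x⊹z)     ≡⟨ cong₂ _⊹_ (cancel₂ planeˣ′ planeʸ′) (cancel₂ planeˣ planeʸ) ⟩
          (f y ⊹ f x⊹z) ⊹ (f y ⊹ f y⊹z)     ≡⟨ interchange commutativeSemigroup (f y) (f x⊹z) (f y) (f y⊹z) ⟩
          (f y ⊹ f y) ⊹ (f x⊹z ⊹ f y⊹z)     ≡⟨ cong ((f y ⊹ f y) ⊹_) (comm (f x⊹z) (f y⊹z)) ⟩
          (f y ⊹ f y) ⊹ (f y⊹z ⊹ f x⊹z)     ∎))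
        where
        open ≡-Reasoning
        open TwoPointPlanes (twoPointPlanes distinct |rest| x∈ y∈ x≁y)
        cancel₂ : ∀ {u v a b a′ b′} → Plane (u ∷ v ∷ a ∷ b ∷ []) → Plane (u ∷ v ∷ a′ ∷ b′ ∷ []) →
                  f a ⊹ f b ≡ f a′ ⊹ f b′
        cancel₂ {u} {v} {a} {b} {a′} {b′} pl pl′ = begin
          f a ⊹ f b            ≡⟨ cong (f a ⊹_) (identityʳ (f b)) ⟨
          f a ⊹ (f b ⊹ 𝟘)      ≡⟨ ∙-cancelˡ (f v) _ _ (∙-cancelˡ (f u) _ _ (plane-sum-constant pl pl′)) ⟩
          f a′ ⊹ (f b′ ⊹ 𝟘)    ≡⟨ cong (f a′ ⊹_) (identityʳ (f b′)) ⟩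
          f a′ ⊹ f b′          ∎

      plane-of-equal-values : ∀ {q w} → Plane q → w ∈ rest → ∑ q ≡ (f w ⊹ f w) ⊹ (f w ⊹ f w)
      plane-of-equal-values {q} {w} ((_ , q++R′↭) , |q| , _) w∈ = begin
        ∑ q                             ≡⟨ F.∑-constant {T = q} (All.tabulate λ v∈ → constant (∈-resp-↭ q++R′↭ (∈-++⁺ˡ v∈)) w∈) ⟩
        length q · u                    ≡⟨ cong (_· u) |q| ⟩
        u ⊹ (u ⊹ (u ⊹ (u ⊹ 𝟘)))         ≡⟨ cong (λ v → u ⊹ (u ⊹ (u ⊹ v))) (identityʳ u) ⟩
        u ⊹ (u ⊹ (u ⊹ u))               ≡⟨ assoc u u (u ⊹ u) ⟨
        (u ⊹ u) ⊹ (u ⊹ u)               ∎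
        where
        open ≡-Reasoning
        u = f w

    module _ (π : Pairing) where
      open Pairing π
      open Planes code 5≤N cls rest using (Plane; TwoPointPlanes; twoPointPlanes; represented; omitted)

      private
        i₀ : Fin N
        i₀ = omitted distinct |rest|

      -- Of three terms in one class any two may form the pair, so each can be moved into R.
      module _ {x y z P R} (split′ : (x ∷ y ∷ z ∷ []) ++ flat P ++ R ↭ S)
               (x~y : κ x ≡ κ y) (y~z : κ y ≡ κ z) (ms : All Matched P) (uniq : Unique (κ z ∷ map κ R))
               (|P| : suc (length P) ≡ 2 * (p ∸ 1)) (|R| : 2 + length R ≡ N) where
        private
          regrouped : ∀ {x′ y′ z′} → x′ ∷ y′ ∷ z′ ∷ [] ↭ x ∷ y ∷ z ∷ [] → κ x′ ≡ κ y′ → κ z′ ≡ κ z → Pairing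
          regrouped {x′} {y′} {z′} perm x′~y′ z′~z = record
            { pairs = (x′ , y′) ∷ P ; rest = z′ ∷ R
            ; split = ↭-trans (prep x′ (prep y′ (shift z′ (flat P) R))) (↭-trans (++⁺ʳ (flat P ++ R) perm) split′)
            ; matched = x′~y′ ∷ ms ; distinct = subst (λ i → Unique (i ∷ map κ R)) (sym z′~z) uniq
            ; |pairs| = |P| ; |rest| = |R|
            }

        values-agree : ∀ {w} → w ∈ R → f x ≡ f w × f y ≡ f w
        values-agree w∈ =
          constant (regrouped (↭-trans (prep y (swap z x ↭-refl)) (swap y x ↭-refl)) y~z (≡-trans x~y y~z)) (here refl) (there w∈) ,
          constant (regrouped (prep x (swap z y ↭-refl)) (≡-trans x~y y~z) y~z) (here refl) (there w∈)

      private
        exchange : ∀ {x y z P R w} → pairs ↭ (x , y) ∷ P → rest ↭ z ∷ R → w ∈ R → κ z ≡ κ x →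
                   Unique (κ z ∷ map κ R) → All Matched ((x , y) ∷ P) → f x ≡ f w × f y ≡ f w
        exchange {x} {y} {z} {P} {R} pairs↭ rest↭ w∈ z~x uniq (x~y ∷ ms) =
          values-agree {x} {y} {z} {P} {R}
            (↭-trans (prep x (prep y (↭-sym (shift z (flat P) R))))
              (↭-trans (++⁺ (↭-sym (flat-↭ pairs↭)) (↭-sym rest↭)) split))
            x~y (≡-trans (sym x~y) (sym z~x)) ms uniq
            (≡-trans (sym (↭-length pairs↭)) |pairs|) (≡-trans (cong suc (sym (↭-length rest↭))) |rest|) w∈

        another : ∀ {z R} → rest ↭ z ∷ R → ∃[ w ] w ∈ R
        another rest↭ = nonempty (≤-trans (s≤s z≤n) (s≤s⁻¹ (s≤s⁻¹
          (subst (5 ≤_) (≡-trans (sym |rest|) (cong suc (↭-length rest↭))) 5≤N))))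

        -- Besides the term `z` in the class of the pair, a term `w` of another class is provided:
        -- it carries the common value, and with `z` it determines a plane whose sum can be
        -- compared.
        pair-values : ∀ {x y} → (x , y) ∈ pairs → κ x ≢ i₀ →
          ∃[ z ] ∃[ w ] z ∈ rest × w ∈ rest × κ z ≢ κ w × f x ≡ f w × f y ≡ f w
        pair-values xy∈ κx≢i₀ =
          let z , z∈ , z~x = represented distinct |rest| κx≢i₀
              P , pairs↭ = ∈⇒↭ xy∈
              R , rest↭ = ∈⇒↭ z∈
              uniq = Unique-resp-↭ (↭-map⁺ κ rest↭) distinct
              w , w∈ = another rest↭
          in z , w , z∈ , ∈-resp-↭ (↭-sym rest↭) (there w∈) , All.lookup (AllPairs.head uniq) (∈-map⁺ κ w∈) ,
             exchange pairs↭ rest↭ w∈ z~x uniq (All-resp-↭ pairs↭ matched)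

      -- In a represented class both terms would have the common value `u` of `rest`; then
      -- `4u = 2u + g s′` makes `g s′` equal to `g (x , y)`, although partners have distinct sums.
      pair-omitted : ∀ {x y} → (x , y) ∈ pairs → κ x ≡ i₀
      pair-omitted {x} {y} xy∈ = decidable-stable (κ x Fin.≟ i₀) (conflict (partner π xy∈) ∘ pair-values xy∈)
        where
        conflict : (∃[ s′ ] g (x , y) ≢ g s′ × (∀ {q} → Plane q → ∑ q ≡ g (x , y) ⊹ g s′)) →
                   (∃[ z ] ∃[ w ] z ∈ rest × w ∈ rest × κ z ≢ κ w × f x ≡ f w × f y ≡ f w) → ⊥
        conflict (s′ , gxy≢ , sum-fixed) (z , w , z∈ , w∈ , z≁w , fx≡ , fy≡) = gxy≢ (≡-trans gxy≡
          (∙-cancelˡ (f w ⊹ f w) _ _ (begin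
            (f w ⊹ f w) ⊹ (f w ⊹ f w)   ≡⟨ plane-of-equal-values π planeˣ w∈ ⟨
            ∑ q                         ≡⟨ sum-fixed planeˣ ⟩
            g (x , y) ⊹ g s′            ≡⟨ cong (_⊹ g s′) gxy≡ ⟩
            (f w ⊹ f w) ⊹ g s′          ∎)))
          where
          open ≡-Reasoning
          open TwoPointPlanes (twoPointPlanes distinct |rest| z∈ w∈ z≁w) using (x⊹y; x⊹y⊹z; x⊹z; planeˣ)
          q = x⊹y ∷ x⊹y⊹z ∷ z ∷ x⊹z ∷ []
          gxy≡ : g (x , y) ≡ f w ⊹ f w
          gxy≡ = cong₂ _⊹_ fx≡ fy≡

      private
        omitted-flat : All (λ x → κ x ≡ i₀) (flat pairs)
        omitted-flat = go (All.tabulate pair-omitted) matched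
          where
          go : ∀ {P} → All (λ (x , y) → κ x ≡ i₀) P → All Matched P → All (λ x → κ x ≡ i₀) (flat P)
          go []         []         = []
          go (x≡ ∷ xs≡) (x~y ∷ ms) = x≡ ∷ ≡-trans (sym x~y) x≡ ∷ go xs≡ ms

        -- With `4p - 4` paired terms this amounts to `3 ≤ p`.
        3p≤ : p + 2 * p ≤ suc (length (flat pairs))
        3p≤ = begin
          p + 2 * p                      ≡⟨ cong (λ i → i + 2 * i) suc[p∸1] ⟨
          suc k + 2 * suc k              ≡⟨ lhs k ⟩
          3 + 3 * k                      ≤⟨ +-monoˡ-≤ (3 * k) (s≤s (∸-monoˡ-≤ 1 3≤p)) ⟩
          suc k + 3 * k                  ≡⟨ rhs k ⟩
          suc (2 * (2 * k))              ≡⟨ cong (λ l → suc (2 * l)) |pairs| ⟨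
          suc (2 * length pairs)         ≡⟨ cong suc (length-flat pairs) ⟨
          suc (length (flat pairs))      ∎
          where
          open ≤-Reasoning
          k = p ∸ 1
          lhs : ∀ k → suc k + 2 * suc k ≡ 3 + 3 * k
          lhs = solve-∀
          rhs : ∀ k → suc k + 3 * k ≡ suc (2 * (2 * k))
          rhs = solve-∀

        2p≤ : ∀ {T U} → T ++ U ↭ flat pairs → length T ≡ p → 2 * p ≤ suc (length U)
        2p≤ {T} {U} T++U↭ |T| = +-cancelˡ-≤ p _ _ (subst (p + 2 * p ≤_) (begin
          suc (length (flat pairs))      ≡⟨ cong suc (↭-length T++U↭) ⟨
          suc (length (T ++ U))          ≡⟨ cong suc (length-++ T) ⟩
          suc (length T + length U)      ≡⟨ cong (λ l → suc (l + length U)) |T| ⟩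
          suc (p + length U)             ≡⟨ +-suc p (length U) ⟨
          p + suc (length U)             ∎) 3p≤)
          where open ≡-Reasoning

      -- All pairs lie in one class, where 3p - 1 ≤ 4p - 4 terms suffice for two
      -- disjoint zero-sum sublists of length p.
      impossible : ⊥
      impossible =
        two-sublists (F.erdős-ginzburg-ziv (flat pairs) (≤-trans (m≤n+m (2 * p) p) 3p≤))
          λ {T} {U} split₁ |T₁| → F.erdős-ginzburg-ziv U (2p≤ {T} {U} split₁ |T₁|)
        where
        two-sublists : F.HasSum p 𝟘 (flat pairs) →
          (∀ {T U} → T ++ U ↭ flat pairs → length T ≡ p → F.HasSum p 𝟘 U) → ⊥
        two-sublists (T₁ , U₁ , split₁ , |T₁| , ∑T₁) second with second {T₁} {U₁} split₁ |T₁|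
        ... | T₂ , U₂ , split₂ , |T₂| , ∑T₂ = bad (T₁ ++ T₂ , U₂ ++ rest ,
               (begin
                 (T₁ ++ T₂) ++ U₂ ++ rest   ≡⟨ ++-assoc (T₁ ++ T₂) U₂ rest ⟨
                 ((T₁ ++ T₂) ++ U₂) ++ rest ≡⟨ cong (_++ rest) (++-assoc T₁ T₂ U₂) ⟩
                 (T₁ ++ T₂ ++ U₂) ++ rest   ↭⟨ ++⁺ʳ rest (↭-trans (++⁺ˡ T₁ split₂) split₁) ⟩
                 flat pairs ++ rest         ↭⟨ split ⟩
                 S                          ∎) ,
               ≡-trans (length-++ T₁) (≡-trans (cong₂ _+_ |T₁| |T₂|) (cong (p +_) (sym (+-identityʳ p)))) ,
               -- Sublists of equal length within one class have equal class sums, and these cancel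
               -- in `V`.
               V.trans (σ-map-++ V cls T₁ T₂)
                 (V.trans (V.∙-congʳ (σ-cong-constant {G = V} cls (≡-trans |T₁| (sym |T₂|)) (class T₁-omitted) (class T₂-omitted)))
                   (x∙x≈ε (σᵛ T₂))) ,
               ≡-trans (σ-map-++ (C p) f T₁ T₂) (≡-trans (cong₂ _⊹_ ∑T₁ ∑T₂) (identityˡ 𝟘)))
          where
          open PermutationReasoning
          omitted₁ = All-resp-↭ (↭-sym split₁) omitted-flat
          T₁-omitted = All.++⁻ˡ T₁ omitted₁
          T₂-omitted = All.++⁻ˡ T₂ (All-resp-↭ (↭-sym split₂) (All.++⁻ʳ T₁ omitted₁))
          class : ∀ {T} → All (λ x → κ x ≡ i₀) T → All (λ x → cls x ≈ Inverse.from code i₀) T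
          class = All.map λ κx≡ → V.trans (V.sym (Inverse.strictlyInverseʳ code _)) (Inverse.from-cong code κx≡)

  zero-sum-sublist : ∀ S → 5 + length S ≡ 4 * p + N → ¬ ¬ Good S
  zero-sum-sublist S |S| bad = Failure.impossible S bad |S| (Failure.pairing S bad |S|)

-- Multiplicativity in n

concat-↭ : {xss yss : List (List A)} → xss ↭ yss → concat xss ↭ concat yss
concat-↭ refl           = refl
concat-↭ (prep xs p)    = ++⁺ˡ xs (concat-↭ p)
concat-↭ (swap xs ys p) = ↭-trans (↭-reflexive (sym (++-assoc xs ys _)))
  (↭-trans (++⁺ (++-comm xs ys) (concat-↭ p)) (↭-reflexive (++-assoc ys xs _)))
concat-↭ (trans p q)    = trans (concat-↭ p) (concat-↭ q)

-- The form with divisibility suits the block weights, which are natural numbers to be multiplied by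
-- `m` afterwards.
erdős-ginzburg-ziv-ℕ : ∀ {q} → Prime q → (v : B → ℕ) → ∀ L → 2 * q ≤ suc (length L) →
  Selects (λ T → length T ≡ q × q ∣ sum (map v T)) L
erdős-ginzburg-ziv-ℕ {q = q} q-prime v L long =
  let T , U , T++U↭L , |T| , ∑T = SumsOfChoices.erdős-ginzburg-ziv q-prime ([_] ∘ v) L long
  in T , U , T++U↭L , |T| , []≡𝟘⇒∣ (≡-trans ([]-sum v T) ∑T)
  where open Residues q {{prime⇒nonZero q-prime}}

module Multiplicativity
  (V : AbelianGroup c ℓ)
  (x∙x≈ε : HasExponent2 V)
  {N : ℕ} (code : Inverse (AbelianGroup.setoid V) (setoid (Fin N))) (5≤N : 5 ≤ N)
  {X : Set a} (cls : X → AbelianGroup.Carrier V) (val : X → ℕ)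
  where
  private module V = AbelianGroup V
  open V using (_≈_; _∙_; ε)

  -- Values stay natural numbers, so that divisibility by `m` and later by `q * m` can be asked of
  -- the same sums.
  Block : ℕ → List X → Set _
  Block m T = length T ≡ 2 * m × σ V (map cls T) ≈ ε × m ∣ sum (map val T)

  -- The double negation lets the prime case argue by contradiction; it is removed at
  -- the end, the existence of a zero-sum subsequence being decidable.
  BlockProperty : ℕ → Set _
  BlockProperty m = ∀ S → 4 * m + N ≤ 5 + length S → ¬ ¬ Selects (Block m) S

  prime⇒blockProperty : ∀ {p} → Prime p → 3 ≤ p → BlockProperty p
  prime⇒blockProperty {p} p-prime 3≤p S long bad =
    -- The prime case concerns one exact length, so `S` is first cut down to `4p + N - 5` terms.
    let S₁ , S₂ , S₁++S₂↭S , |S₁| = splitAt-length (4 * p + N ∸ 5) S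
          (m≤n+o⇒m∸n≤o (4 * p + N) 5 long)
    in PrimeCase.zero-sum-sublist V x∙x≈ε code 5≤N p-prime 3≤p cls ([_] ∘ val) S₁
         (≡-trans (cong (5 +_) |S₁|) (m+[n∸m]≡n (≤-trans 5≤N (m≤n+m N (4 * p)))))
         λ (T , U , T++U↭ , |T| , σT , ∑T) → bad (Selects-⊆ S₂ S₁++S₂↭S
           (T , U , T++U↭ , |T| , σT , []≡𝟘⇒∣ (≡-trans ([]-sum val T) ∑T)))
    where open Residues p {{prime⇒nonZero p-prime}}

  module _ {m : ℕ} .{{_ : NonZero m}} (property : BlockProperty m) where

    Blocks : ℕ → List X → Set _
    Blocks k S = ∃[ Bs ] ∃[ U ] concat Bs ++ U ↭ S × All (Block m) Bs × length Bs ≡ k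

    -- Each block uses up `2 * m` terms, and the bound is such that `4 * m + N - 5` terms are still
    -- there when the last block is taken.
    blocks : ∀ k S → k * (2 * m) + (2 * m + N) ≤ 5 + length S → ¬ ¬ Blocks k S
    blocks zero    S _    none = none ([] , S , ↭-refl , [] , refl)
    blocks (suc k) S long none = property S
      (≤-trans (≤-trans (m≤n+m (4 * m + N) (k * (2 * m))) (≤-reflexive (regroup (k * (2 * m)) m N))) long)
      λ (T , U , T++U↭S , block@(|T| , _)) → blocks k U (shorter T U T++U↭S |T|)
      λ (Bs , W , Bs++W↭U , bs , |Bs|) → none (T ∷ Bs , W ,
        ↭-trans (↭-reflexive (++-assoc T (concat Bs) W)) (↭-trans (++⁺ˡ T Bs++W↭U) T++U↭S) ,
        block ∷ bs , cong suc |Bs|)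
      where
      regroup : ∀ a m N → a + (4 * m + N) ≡ (2 * m + a) + (2 * m + N)
      regroup = solve-∀
      shorter : ∀ T U → T ++ U ↭ S → length T ≡ 2 * m → k * (2 * m) + (2 * m + N) ≤ 5 + length U
      shorter T U T++U↭S |T| = +-cancelˡ-≤ (2 * m) _ _ (begin
        2 * m + (k * (2 * m) + (2 * m + N))   ≡⟨ +-assoc (2 * m) _ _ ⟨
        2 * m + k * (2 * m) + (2 * m + N)     ≤⟨ long ⟩
        5 + length S                          ≡⟨ cong (5 +_) (↭-length T++U↭S) ⟨
        5 + length (T ++ U)                   ≡⟨ cong (5 +_) (≡-trans (length-++ T) (cong (_+ length U) |T|)) ⟩
        5 + (2 * m + length U)                ≡⟨ swap-sum (2 * m) (length U) ⟩
        2 * m + (5 + length U)                ∎)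
        where
        open ≤-Reasoning
        swap-sum : ∀ a b → 5 + (a + b) ≡ a + (5 + b)
        swap-sum = solve-∀

    private
      -- For a block the division is exact, and the weight modulo `q` represents its value sum under
      -- `m C_qm ≅ C_q`.
      weight : List X → ℕ
      weight T = sum (map val T) / m

    concat-length : ∀ {Bs} → All (Block m) Bs → length (concat Bs) ≡ length Bs * (2 * m)
    concat-length []                          = refl
    concat-length {B ∷ Bs} ((|B| , _) ∷ bs) = ≡-trans (length-++ B) (cong₂ _+_ |B| (concat-length bs))

    concat-σ : ∀ {Bs} → All (Block m) Bs → σ V (map cls (concat Bs)) ≈ ε
    concat-σ []                              = V.refl
    concat-σ {B ∷ Bs} ((_ , σB , _) ∷ bs) = V.trans (σ-map-++ V cls B (concat Bs))
      (V.trans (V.∙-cong σB (concat-σ bs)) (V.identityˡ ε))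

    concat-sum : ∀ {Bs} → All (Block m) Bs → sum (map val (concat Bs)) ≡ m * sum (map weight Bs)
    concat-sum []                                = sym (*-zeroʳ m)
    concat-sum {B ∷ Bs} ((_ , _ , m∣B) ∷ bs) = begin
      sum (map val (B ++ concat Bs))                  ≡⟨ cong sum (map-++ val B (concat Bs)) ⟩
      sum (map val B ++ map val (concat Bs))          ≡⟨ sum-++ (map val B) _ ⟩
      sum (map val B) + sum (map val (concat Bs))     ≡⟨ cong₂ _+_ (sym (m*[n/m]≡n m∣B)) (concat-sum bs) ⟩
      m * weight B + m * sum (map weight Bs)          ≡⟨ *-distribˡ-+ m (weight B) _ ⟨
      m * (weight B + sum (map weight Bs))            ∎
      where open ≡-Reasoning

    blockProperty-* : ∀ {q} → Prime q → BlockProperty (q * m)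
    blockProperty-* {q} q-prime S long bad = blocks (pred (2 * q)) S enough
      λ (Bs , W , Bs++W↭S , bs , |Bs|) →
        let Ts , Us , Ts++Us↭Bs , |Ts| , q∣ = erdős-ginzburg-ziv-ℕ q-prime weight Bs
              (≤-reflexive (≡-trans (sym suc[pred]) (cong suc (sym |Bs|))))
            ts = All.++⁻ˡ Ts (All-resp-↭ (↭-sym Ts++Us↭Bs) bs)
        in bad (Selects-⊆ W Bs++W↭S (concat Ts , concat Us ,
             ↭-trans (↭-reflexive (concat-++ Ts Us)) (concat-↭ Ts++Us↭Bs) ,
             ≡-trans (concat-length ts) (≡-trans (cong (_* (2 * m)) |Ts|) (commute q m)) ,
             concat-σ ts ,
             subst (q * m ∣_) (≡-trans (*-comm _ m) (sym (concat-sum ts))) (*-monoˡ-∣ m q∣)))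
      where
      instance
        2q≢0 : NonZero (2 * q)
        2q≢0 = m*n≢0 2 q {{_}} {{prime⇒nonZero q-prime}}
      suc[pred] : suc (pred (2 * q)) ≡ 2 * q
      suc[pred] = suc-pred (2 * q)
      commute : ∀ q m → q * (2 * m) ≡ 2 * (q * m)
      commute = solve-∀
      -- There is room for `2q - 1` blocks, since `(2q - 1) * 2m + 2m + N = 4qm + N`.
      enough : pred (2 * q) * (2 * m) + (2 * m + N) ≤ 5 + length S
      enough = begin
        pred (2 * q) * (2 * m) + (2 * m + N)    ≡⟨ lhs (pred (2 * q)) m N ⟩
        suc (pred (2 * q)) * (2 * m) + N        ≡⟨ cong (λ k → k * (2 * m) + N) suc[pred] ⟩
        2 * q * (2 * m) + N                     ≡⟨ rhs q m N ⟩
        4 * (q * m) + N                         ≤⟨ long ⟩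
        5 + length S                            ∎
        where
        open ≤-Reasoning
        lhs : ∀ k m N → k * (2 * m) + (2 * m + N) ≡ suc k * (2 * m) + N
        lhs = solve-∀
        rhs : ∀ q m N → 2 * q * (2 * m) + N ≡ 4 * (q * m) + N
        rhs = solve-∀

  -- Induction over the prime factors: the last one is the prime case, being at least 3 by oddness,
  -- and the earlier ones are multiplied on.
  odd⇒blockProperty : ∀ q qs → All Prime (q ∷ qs) → ¬ 2 ∣ product (q ∷ qs) → BlockProperty (product (q ∷ qs))
  odd⇒blockProperty q [] (q-prime ∷ []) odd = subst BlockProperty (sym (*-identityʳ q))
    (prime⇒blockProperty q-prime (≤∧≢⇒< (nonTrivial⇒n>1 q {{prime⇒nonTrivial q-prime}})
      λ { refl → odd (m∣m*n 1) }))
  odd⇒blockProperty q (q′ ∷ qs) (q-prime ∷ primes) odd =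
    blockProperty-* {{>-nonZero (productOfPrimes≥1 primes)}}
      (odd⇒blockProperty q′ qs primes (λ 2∣ → odd (∣-trans 2∣ (n∣m*n q)))) q-prime

-- Decidability and existence of the constant

-- Finiteness in the form of exhaustive search, for predicates of every level; hence the sort
-- `Setω`.
Exhaustible : Set a → Setω
Exhaustible A = ∀ {p} {P : A → Set p} → Decidable P → Dec (∀ x → P x)

exhaustible-list : Exhaustible A → ∀ {p} {P : List A → Set p} → Decidable P →
                   ∀ l → Dec (∀ xs → length xs ≡ l → P xs)
exhaustible-list {A = A} ex {P = P} P? zero = map′ to (λ h → h [] refl) (P? [])
  where
  to : P [] → ∀ xs → length xs ≡ 0 → P xs
  to h [] _ = h
exhaustible-list {A = A} ex {P = P} P? (suc l) = map′ to (λ h x xs |xs| → h (x ∷ xs) (cong suc |xs|))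
  (ex λ x → exhaustible-list ex (λ xs → P? (x ∷ xs)) l)
  where
  to : (∀ x xs → length xs ≡ l → P (x ∷ xs)) → ∀ xs → length xs ≡ suc l → P xs
  to h (x ∷ xs) |xs| = h x xs (suc-injective |xs|)

module SubsequenceSums (G : AbelianGroup c ℓ) (_≟_ : ∀ x y → Dec (AbelianGroup._≈_ G x y)) where
  private module G = AbelianGroup G
  open G using (Carrier; _≈_; _∙_; ε; _⁻¹)
  open Permutation G.setoid using ()
    renaming (_↭_ to _↭ₛ_; refl to reflₛ; prep to prepₛ; swap to swapₛ; trans to transₛ)
  open GroupProperties G.group using (\\-leftDividesˡ; \\-leftDividesʳ)

  -- An inductive description of the sums of `k`-term sublists, decidable by recursion on the list
  -- without searching through permutations.
  data Reach : List Carrier → ℕ → Carrier → Set (c Level.⊔ ℓ) where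
    done : ∀ {g} → ε ≈ g → Reach [] 0 g
    skip : ∀ {x S k g} → Reach S k g → Reach (x ∷ S) k g
    pick : ∀ {x S k g h} → x ∙ h ≈ g → Reach S k h → Reach (x ∷ S) (suc k) g

  reach-≈ : ∀ {S k g h} → g ≈ h → Reach S k g → Reach S k h
  reach-≈ g≈h (done eq)   = done (G.trans eq g≈h)
  reach-≈ g≈h (skip r)    = skip (reach-≈ g≈h r)
  reach-≈ g≈h (pick eq r) = pick (G.trans eq g≈h) r

  reach? : ∀ S k g → Dec (Reach S k g)
  reach? []      zero    g = map′ done (λ { (done eq) → eq }) (ε ≟ g)
  reach? []      (suc k) g = no λ ()
  reach? (x ∷ S) zero    g = map′ skip (λ { (skip r) → r }) (reach? S zero g)
  reach? (x ∷ S) (suc k) g = map′ to from (reach? S (suc k) g ⊎-dec reach? S k (x ⁻¹ ∙ g))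
    where
    to : Reach S (suc k) g ⊎ Reach S k (x ⁻¹ ∙ g) → Reach (x ∷ S) (suc k) g
    to (inj₁ r) = skip r
    to (inj₂ r) = pick (\\-leftDividesˡ x g) r
    from : Reach (x ∷ S) (suc k) g → Reach S (suc k) g ⊎ Reach S k (x ⁻¹ ∙ g)
    from (skip r)    = inj₁ r
    from (pick eq r) = inj₂ (reach-≈ (G.trans (G.sym (\\-leftDividesʳ x _)) (G.∙-congˡ eq)) r)

  reach-↭ : ∀ {S S′ k g} → S ↭ₛ S′ → Reach S k g → Reach S′ k g
  reach-↭ (reflₛ [])           r           = r
  reach-↭ (reflₛ (eq ∷ eqs))   (skip r)    = skip (reach-↭ (reflₛ eqs) r)
  reach-↭ (reflₛ (eq ∷ eqs))   (pick e r)  = pick (G.trans (G.∙-congʳ (G.sym eq)) e) (reach-↭ (reflₛ eqs) r)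
  reach-↭ (prepₛ eq p)         (skip r)    = skip (reach-↭ p r)
  reach-↭ (prepₛ eq p)         (pick e r)  = pick (G.trans (G.∙-congʳ (G.sym eq)) e) (reach-↭ p r)
  reach-↭ (swapₛ x≈ y≈ p) (skip (skip r))       = skip (skip (reach-↭ p r))
  reach-↭ (swapₛ x≈ y≈ p) (skip (pick e r))     = pick (G.trans (G.∙-congʳ (G.sym y≈)) e) (skip (reach-↭ p r))
  reach-↭ (swapₛ x≈ y≈ p) (pick e (skip r))     = skip (pick (G.trans (G.∙-congʳ (G.sym x≈)) e) (reach-↭ p r))
  reach-↭ (swapₛ {x = x} {y} x≈ y≈ p) (pick e (pick {h = h} e′ r)) =
    pick (G.trans (G.∙-cong (G.sym y≈) (G.∙-congʳ (G.sym x≈)))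
      (G.trans (x∙yz≈y∙xz G.commutativeSemigroup y x h) (G.trans (G.∙-congˡ e′) e)))
      (pick G.refl (reach-↭ p r))
  reach-↭ (transₛ p q) r = reach-↭ q (reach-↭ p r)

  reach-++ : ∀ T U → Reach (T ++ U) (length T) (σ G T)
  reach-++ []      []      = done G.refl
  reach-++ []      (_ ∷ U) = skip (reach-++ [] U)
  reach-++ (x ∷ T) U       = pick G.refl (reach-++ T U)

  reach-weaken : ∀ {S k g} U → Reach S k g → Reach (S ++ U) k g
  reach-weaken []      (done eq)   = done eq
  reach-weaken (_ ∷ U) (done eq)   = skip (reach-weaken U (done eq))
  reach-weaken U       (skip r)    = skip (reach-weaken U r)
  reach-weaken U       (pick e r)  = pick e (reach-weaken U r)

  reach⇒sublist : ∀ {S k g} → Reach S k g → ∃[ T ] ∃[ U ] T ++ U ↭ S × σ G T ≈ g × length T ≡ k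
  reach⇒sublist (done eq) = [] , [] , ↭-refl , eq , refl
  reach⇒sublist {x ∷ _} (skip r) with T , U , p , σT , |T| ← reach⇒sublist r =
    T , x ∷ U , ↭-trans (shift x T U) (prep x p) , σT , |T|
  reach⇒sublist {x ∷ _} (pick e r) with T , U , p , σT , |T| ← reach⇒sublist r =
    x ∷ T , U , prep x p , G.trans (G.∙-congˡ σT) e , cong suc |T|

  HasZeroSum : ℕ → List Carrier → Set (c Level.⊔ ℓ)
  HasZeroSum e S = ∃[ T ] Subsequence G T S × ZeroSum G T × length T ≡ e

  reach⇒zeroSum : ∀ {e S} → Reach S e ε → HasZeroSum e S
  reach⇒zeroSum r with T , U , p , rest ← reach⇒sublist r = T , (U , ↭⇒↭ₛ′ G.isEquivalence p) , rest

  zeroSum⇒reach : ∀ {e S} → HasZeroSum e S → Reach S e ε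
  zeroSum⇒reach (T , (U , p) , σT , refl) = reach-≈ σT (reach-↭ p (reach-++ T U))

  hasZeroSum? : ∀ e S → Dec (HasZeroSum e S)
  hasZeroSum? e S = map′ reach⇒zeroSum zeroSum⇒reach (reach? S e ε)

  -- Sequences of length exactly `l` suffice, since a zero-sum subsequence of a prefix is one of the
  -- whole sequence.
  egzProperty? : Exhaustible Carrier → ∀ e l → Dec (EGZProperty G e l)
  egzProperty? ex e l = map′ to (λ h S |S| → h S (≤-reflexive (sym |S|)))
    (exhaustible-list ex (hasZeroSum? e) l)
    where
    to : (∀ S → length S ≡ l → HasZeroSum e S) → EGZProperty G e l
    to h S l≤ with T , U , p , |T| ← splitAt-length l S l≤ =
      reach⇒zeroSum (reach-↭ (↭⇒↭ₛ′ G.isEquivalence p) (reach-weaken U (zeroSum⇒reach (h T |T|))))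

least-positive : ∀ {p} {P : ℕ → Set p} → Decidable P → ∀ m → 0 < m → P m →
                 ∃[ s ] IsLeastPositive P s × s ≤ m
least-positive {P = P} P? m 0<m Pm with search m
  where
  search : ∀ n → (∃[ s ] IsLeastPositive P s × s ≤ n) ⊎ (∀ k → 0 < k → k ≤ n → ¬ P k)
  search zero = inj₂ λ { k 0<k k≤0 _ → contradiction k≤0 (<⇒≱ 0<k) }
  search (suc n) with search n | P? (suc n)
  ... | inj₁ (s , least , s≤n) | _ = inj₁ (s , least , m≤n⇒m≤1+n s≤n)
  ... | inj₂ none | yes P[1+n] = inj₁ (suc n ,
    (s≤s z≤n , P[1+n] , λ k 0<k Pk → ≮⇒≥ λ k<1+n → none k 0<k (s≤s⁻¹ k<1+n) Pk) , ≤-refl)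
  ... | inj₂ none | no ¬P[1+n] = inj₂ λ k 0<k k≤1+n Pk → [ (λ k<1+n → none k 0<k (s≤s⁻¹ k<1+n) Pk) , (λ { refl → ¬P[1+n] Pk }) ]′ (m≤n⇒m<n∨m≡n k≤1+n)
... | inj₁ found = found
... | inj₂ none  = contradiction Pm (none m 0<m ≤-refl)

-- The groups `C_2^r`: search, decidable equality, torsion and enumeration

exhaustible-× : {A : Set a} {B : Set b} → Exhaustible A → Exhaustible B → Exhaustible (A × B)
exhaustible-× exA exB P? = map′ (λ h (x , y) → h x y) (λ h x y → h (x , y)) (exA λ x → exB λ y → P? (x , y))

C^-exhaustible : ∀ r → Exhaustible (AbelianGroup.Carrier (C 2 ^⊕ r))
C^-exhaustible zero    P? = map′ (λ h _ → h) (λ h → h tt) (P? tt)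
C^-exhaustible (suc r)    = exhaustible-× all? (C^-exhaustible r)

C^-dec : ∀ r x y → Dec (AbelianGroup._≈_ (C 2 ^⊕ r) x y)
C^-dec zero    _       _       = yes tt
C^-dec (suc r) (x , u) (y , v) = (x Fin.≟ y) ×-dec C^-dec r u v

C^-torsion : ∀ r → HasExponent2 (C 2 ^⊕ r)
C^-torsion zero    _                     = tt
C^-torsion (suc r) (Fin.zero , u)         = refl , C^-torsion r u
C^-torsion (suc r) (Fin.suc Fin.zero , u) = refl , C^-torsion r u

C^-code : ∀ r → Inverse (AbelianGroup.setoid (C 2 ^⊕ r)) (setoid (Fin (2 ^ r)))
C^-code zero = record
  { to = λ _ → Fin.zero ; from = λ _ → tt ; to-cong = λ _ → refl ; from-cong = λ _ → tt
  ; inverse = (λ { {Fin.zero} _ → refl }) , λ _ → tt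
  }
C^-code (suc r) = record
  { to        = λ (x , u) → combine x (to u)
  ; from      = λ i → let x , j = remQuot (2 ^ r) i in x , from j
  ; to-cong   = λ (x≡y , u≈v) → cong₂ combine x≡y (to-cong u≈v)
  ; from-cong = λ { refl → refl , V.refl }
  ; inverse   = (λ {i} eq → ≡-trans (cong₂ combine (proj₁ eq) (inverseˡ (proj₂ eq))) (combine-remQuot (2 ^ r) i))
              , λ { {x , u} refl → cong proj₁ (remQuot-combine x (to u)) , inverseʳ (cong proj₂ (remQuot-combine x (to u))) }
  }
  where
  module V = AbelianGroup (C 2 ^⊕ r)
  open Inverse (C^-code r)

-- From classes in `C_2^r` and residues modulo `n` back to the original group

σ-⊕₁ : ∀ {G H : AbelianGroup c ℓ} xs → proj₁ (σ (G ⊕ H) xs) ≡ σ G (map proj₁ xs)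
σ-⊕₁ []                = refl
σ-⊕₁ {G = G} {H} (x ∷ xs) = cong (AbelianGroup._∙_ G (proj₁ x)) (σ-⊕₁ {G = G} {H} xs)

σ-⊕₂ : ∀ {G H : AbelianGroup c ℓ} xs → proj₂ (σ (G ⊕ H) xs) ≡ σ H (map proj₂ xs)
σ-⊕₂ []                = refl
σ-⊕₂ {G = G} {H} (x ∷ xs) = cong (AbelianGroup._∙_ H (proj₂ x)) (σ-⊕₂ {G = G} {H} xs)

module _ (r n : ℕ) .{{_ : NonZero n}} (odd : ¬ 2 ∣ n) where
  private
    instance
      2n≢0 : NonZero (2 * n)
      2n≢0 = m*n≢0 2 n

  Group : AbelianGroup 0ℓ 0ℓ
  Group = (C 2 ^⊕ r) ⊕ C (2 * n)
  private
    module G = AbelianGroup Group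
    module V = AbelianGroup (C 2 ^⊕ suc r)
    module R₂ = Residues 2
    module R₂ₙ = Residues (2 * n)

  -- Here `r` is one less than in the theorem, and the parity of the cyclic coordinate supplies the
  -- remaining copy of `C 2`. With `val` modulo `n` this realises `C_2n ≅ C_2 ⊕ C_n` for odd `n`.
  cls : G.Carrier → V.Carrier
  cls (v , i) = R₂.[ toℕ i ] , v

  val : G.Carrier → ℕ
  val (_ , i) = toℕ i

  -- Odd `n` is coprime to 2, so it divides the half of any even multiple of it.
  2n∣ : ∀ {k} → 2 ∣ k → n ∣ k → 2 * n ∣ k
  2n∣ (divides j refl) n∣ = subst (2 * n ∣_) (*-comm 2 j)
    (*-monoʳ-∣ 2 n∣j)
    where
    coprime : Coprime n 2
    coprime (d∣n , d∣2) with prime⇒irreducible prime[2] d∣2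
    ... | inj₁ d≡1  = d≡1
    ... | inj₂ refl = contradiction d∣n odd
    n∣j : n ∣ j
    n∣j = coprime-divisor coprime (subst (n ∣_) (*-comm j 2) n∣)

  -- The parity coordinate of the class sum says that the sum of values is even; together with
  -- divisibility by `n` this gives zero in `C (2 * n)`.
  zero-sum : ∀ T → σ (C 2 ^⊕ suc r) (map cls T) V.≈ V.ε → n ∣ sum (map val T) → ZeroSum Group T
  zero-sum T (σ₁ , σ₂) n∣ =
    U.trans (U.reflexive (begin
      proj₁ (σ Group T)                           ≡⟨ σ-⊕₁ {G = C 2 ^⊕ r} {C (2 * n)} T ⟩
      σ (C 2 ^⊕ r) (map proj₁ T)                  ≡⟨ cong (σ (C 2 ^⊕ r)) (map-∘ T) ⟩
      σ (C 2 ^⊕ r) (map proj₂ (map cls T))        ≡⟨ σ-⊕₂ {G = C 2} {C 2 ^⊕ r} (map cls T) ⟨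
      proj₂ (σ (C 2 ^⊕ suc r) (map cls T))        ∎)) σ₂ ,
    (begin
      proj₂ (σ Group T)                           ≡⟨ σ-⊕₂ {G = C 2 ^⊕ r} {C (2 * n)} T ⟩
      σ (C (2 * n)) (map proj₂ T)                 ≡⟨ cong (σ (C (2 * n))) (map-cong (λ (_ , i) → R₂ₙ.[]-toℕ i) T) ⟨
      σ (C (2 * n)) (map (R₂ₙ.[_] ∘ val) T)       ≡⟨ R₂ₙ.[]-sum val T ⟨
      R₂ₙ.[ sum (map val T) ]                     ≡⟨ R₂ₙ.∣⇒[]≡𝟘 (2n∣ (R₂.[]≡𝟘⇒∣ even) n∣) ⟩
      R₂ₙ.𝟘                                       ∎)
    where
    module U = AbelianGroup (C 2 ^⊕ r)
    open ≡-Reasoning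
    even : R₂.[ sum (map val T) ] ≡ R₂.𝟘
    even = begin
      R₂.[ sum (map val T) ]                      ≡⟨ R₂.[]-sum val T ⟩
      σ (C 2) (map (R₂.[_] ∘ val) T)              ≡⟨ cong (σ (C 2)) (map-∘ T) ⟩
      σ (C 2) (map proj₁ (map cls T))             ≡⟨ σ-⊕₁ {G = C 2} {C 2 ^⊕ r} (map cls T) ⟨
      proj₁ (σ (C 2 ^⊕ suc r) (map cls T))        ≡⟨ σ₁ ⟩
      R₂.𝟘                                        ∎

  private
    module × = Mult G.monoid
    module ×₁ = Mult (AbelianGroup.monoid (C 2 ^⊕ r))

    ×-proj₁ : ∀ k g → proj₁ (k ×.× g) ≡ k ×₁.× proj₁ g
    ×-proj₁ zero    g = refl
    ×-proj₁ (suc k) g = cong (AbelianGroup._∙_ (C 2 ^⊕ r) (proj₁ g)) (×-proj₁ k g)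

    ×-proj₂ : ∀ k g → proj₂ (k ×.× g) ≡ k R₂ₙ.· proj₂ g
    ×-proj₂ zero    g = refl
    ×-proj₂ (suc k) g = cong (proj₂ g R₂ₙ.⊹_) (×-proj₂ k g)

  exponent : IsExponent Group (2 * n)
  exponent = >-nonZero⁻¹ (2 * n) , annihilates , minimal
    where
    module U = AbelianGroup (C 2 ^⊕ r)
    annihilates : ∀ g → (2 * n) ×.× g G.≈ G.ε
    annihilates g@(v , i) =
      U.trans (U.reflexive (×-proj₁ (2 * n) g)) (U.trans (×₁.×-homo-+ v n (n + 0))
        (U.trans (U.∙-congˡ (×₁.×-congˡ (+-identityʳ n))) (C^-torsion r (n ×₁.× v)))) ,
      ≡-trans (×-proj₂ (2 * n) g) (R₂ₙ.∣⇒·≡𝟘 i ∣-refl)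
    minimal : ∀ k → 0 < k → (∀ g → k ×.× g G.≈ G.ε) → 2 * n ≤ k
    -- Minimality is tested on the generator of the cyclic summand.
    minimal k 0<k h = ∣⇒≤ {{>-nonZero 0<k}} (subst (2 * n ∣_) (*-identityʳ k) (R₂ₙ.[]≡𝟘⇒∣ (begin
      R₂ₙ.[ k * 1 ]                        ≡⟨ R₂ₙ.[]-homo-· k 1 ⟨
      k R₂ₙ.· R₂ₙ.[ 1 ]                    ≡⟨ ×-proj₂ k (U.ε , R₂ₙ.[ 1 ]) ⟨
      proj₂ (k ×.× (U.ε , R₂ₙ.[ 1 ]))      ≡⟨ proj₂ (h (U.ε , R₂ₙ.[ 1 ])) ⟩
      R₂ₙ.𝟘                                ∎)))
      where open ≡-Reasoning

  open SubsequenceSums Group (λ (u , i) (v , j) → C^-dec r u v ×-dec (i Fin.≟ j))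

  egzProperty : 3 ≤ suc r → 3 ≤ n → EGZProperty Group (2 * n) (4 * n + 2 ^ suc r ∸ 5)
  egzProperty 3≤r 3≤n S long = decidable-stable (hasZeroSum? (2 * n) S) λ none →
    blockProperty S (≤-trans (m≤n+m∸n (4 * n + 2 ^ suc r) 5) (+-monoʳ-≤ 5 long))
      λ (T , U , T++U↭S , |T| , σT , n∣) →
        none (T , (U , ↭⇒↭ₛ′ G.isEquivalence T++U↭S) , zero-sum T σT n∣ , |T|)
    where
    open Multiplicativity (C 2 ^⊕ suc r) (C^-torsion (suc r)) (C^-code (suc r))
      -- `5 ≤ 8 = 2 ^ 3 ≤ 2 ^ suc r`.
      (≤-trans (m≤m+n 5 3) (^-monoʳ-≤ 2 3≤r)) cls val
    open PrimeFactorisation (factorise n)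
    blockProperty : BlockProperty n
    blockProperty with factors | isFactorisation | factorsPrime
    -- An empty factorisation would mean `n = 1`.
    ... | []     | refl | _      = contradiction 3≤n λ { (s≤s ()) }
    ... | q ∷ qs | refl | primes = odd⇒blockProperty q qs primes odd

  bounded-constant : 3 ≤ suc r → 3 ≤ n → ∃[ s ] IsEGZConstant Group s × s ≤ 4 * n + 2 ^ suc r ∸ 5
  bounded-constant 3≤r 3≤n
    with s , least , s≤ ← least-positive
           (egzProperty? (exhaustible-× (C^-exhaustible r) all?) (2 * n))
           (4 * n + 2 ^ suc r ∸ 5)
           -- `5 < 12 ≤ 4 * n`, so the truncated subtraction leaves a positive bound.
           (m<n⇒0<n∸m (≤-trans (≤-trans (m≤m+n 6 6) (*-monoʳ-≤ 4 3≤n)) (m≤m+n (4 * n) (2 ^ suc r))))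
           (egzProperty 3≤r 3≤n)
    = s , (2 * n , exponent , least) , s≤

theorem1p1 : (r n : ℕ) .{{_ : NonZero n}} → 3 ≤ r → 3 ≤ n → n % 2 ≡ 1 →
    ∃[ s ] IsEGZConstant ((C 2 ^⊕ (r ∸ 1)) ⊕ C (2 * n) {{m*n≢0 2 n}}) s
    × s ≤ 4 * n + 2 ^ r ∸ 5
theorem1p1 (suc r) n 3≤r 3≤n n%2≡1 = bounded-constant r n odd 3≤r 3≤n
  where
  odd : ¬ 2 ∣ n
  odd 2∣n = contradiction (≡-trans (sym n%2≡1) (n∣m⇒m%n≡0 n 2 2∣n)) λ ()
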